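{- $$\mathbf{W}(3)=\frac{2}{1-\tau^*(3)},$$ where $\mathbf{W}(3)=\lim_{n\to\infty}\mathrm{wR}(n,3)$ is the weighted Ramsey limit for $k=3$ and $\tau^*(3)=\lim_{n\to\infty}\tau^*(n,3)/\binom{n}{2}$ is the normalized limit of the minimum fractional packing number of monochromatic triangles in $2$-edge-colorings of $K_n$.
   Context: Weighted Ramsey number: for $n\ge 3$, $\mathrm{wR}(n,3)$ is the minimum $q$ such that there is an assignment of nonnegative real weights to the edges of $K_n$ with total sum $\binom{n}{2}$, and a Red/Blue coloring of the edges of the same $K_n$, such that in every complete $3$-vertex subgraph $H$ of $K_n$, the sum of the weights on Red edges of $H$ is at most $q$ and the sum of the weights on Blue edges of $H$ is at most $q$. $\mathbf{W}(3):=\lim_{n\to\infty}\mathrm{wR}(n,3)$ (this limit exists, by monotonicity in $n$ and boundedness). Fractional triangle packing number: for a graph $G$, let $\mathcal{T}_3(G)$ be the set of triangles (complete $3$-vertex subgraphs) of $G$. Then $$\tau^*(G)=\max\sum_{T\in\mathcal{T}_3(G)}g(T)$$ over all functions $g:\mathcal{T}_3(G)\to\mathbb{R}$ with $g(T)\ge 0$ for all $T\in\mathcal{T}_3(G)$ and $\sum_{T\in\mathcal{T}_3(G),\,T\ni e}g(T)\le 1$ for every $e\in E(G)$, where $T\ni e$ means that $e$ is an edge of $T$. Let $\tau^*(n,3):=\min\{\tau^*(R)+\tau^*(B)\}$, the minimum over all $2$-edge-colorings of $K_n$, where $R$ and $B$ are the graphs formed by the two color classes. Let $\tau^*(3):=\lim_{n\to\infty}\tau^*(n,3)/\binom{n}{2}$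 (this limit exists, by monotonicity and boundedness). -}

module Defs where

open import Algebra.Bundles using (CommutativeRing)
open import Data.Bool.Base using (Bool; true; false; T; if_then_else_)
open import Data.Bool.Properties using (T?)
open import Data.Fin.Base using (Fin; _<_)
open import Data.Fin.Properties using (_<?_; <-trans) renaming (_≟_ to _≟ᶠ_)
open import Data.Nat.Base as ℕ using (ℕ)
open import Data.Nat.Combinatorics using (_C_)
open import Data.Product.Base using (∃; ∃-syntax; Σ-syntax; _×_; _,_)
open import Data.Sum.Base using (_⊎_)
open import Level using (0ℓ)
open import Relation.Binary.Core using (Rel)
open import Relation.Binary.Definitions using (DecidableEquality)
open import Relation.Binary.PropositionalEquality.Core using (_≡_; refl)
open import Relation.Binary.Structures using (IsDecTotalOrder)
open import Relation.Nullary using (¬_; Dec; yes; no)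
open import Relation.Nullary.Decidable using (_×-dec_; _⊎-dec_)

import Algebra.Definitions.RawMonoid as RawMonoidDefs
import Algebra.Properties.CommutativeMonoid.Sum as CommutativeMonoidSum
import Relation.Binary.Construct.NonStrictToStrict as NonStrictToStrict

-- The real numbers, axiomatised as a Dedekind-complete ordered field.  The
-- order is decidable and completeness is with respect to arbitrary predicates:
-- this is the classical continuum, not one of its constructive variants.

record Reals : Set₁ where
  infix 4 _≤_
  infix 9 _⁻¹
  infixl 7 _/_
  field
    commutativeRing : CommutativeRing 0ℓ 0ℓ

  open CommutativeRing commutativeRing public

  field
    _≤_             : Rel Carrier 0ℓ
    isDecTotalOrder : IsDecTotalOrder _≈_ _≤_
    1≉0             : ¬ (1# ≈ 0#)
    +-monoˡ-≤       : ∀ z {x y} → x ≤ y → x + z ≤ y + z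
    *-nonNegative   : ∀ {x y} → 0# ≤ x → 0# ≤ y → 0# ≤ x * y

    -- The inverse is a total function; 0# ⁻¹ is unspecified.
    _⁻¹             : Carrier → Carrier
    ⁻¹-cong         : ∀ {x y} → x ≈ y → x ⁻¹ ≈ y ⁻¹
    ⁻¹-inverseʳ     : ∀ x → ¬ (x ≈ 0#) → x * x ⁻¹ ≈ 1#

  UpperBound : (Carrier → Set) → Carrier → Set
  UpperBound P u = ∀ x → P x → x ≤ u

  field
    supremum : (P : Carrier → Set) → ∃ P → ∃ (UpperBound P) →
               ∃[ s ] (UpperBound P s × (∀ u → UpperBound P u → s ≤ u))

  open NonStrictToStrict _≈_ _≤_ public using () renaming (_<_ to _<ᵣ_)

  open CommutativeMonoidSum +-commutativeMonoid public using (sum)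

  _/_ : Carrier → Carrier → Carrier
  x / y = x * y ⁻¹

  fromℕ : ℕ → Carrier
  fromℕ n = n · 1#
    where open RawMonoidDefs +-rawMonoid renaming (_×_ to _·_)

  IsMinimum : (Carrier → Set) → Carrier → Set
  IsMinimum P m = P m × (∀ x → P x → m ≤ x)

  IsMaximum : (Carrier → Set) → Carrier → Set
  IsMaximum P m = P m × UpperBound P m

  IsLimit : (ℕ → Carrier) → Carrier → Set
  IsLimit a L = ∀ ε → 0# <ᵣ ε →
    ∃[ N ] (∀ n → N ℕ.≤ n → (L - ε <ᵣ a n) × (a n <ᵣ L + ε))

-- The edge set of the complete graph on Fin n.  The irrelevant field makes an
-- edge determined by its two endpoints.

record Edge (n : ℕ) : Set where
  constructor edge
  field
    i j  : Fin n
    .i<j : i < j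

_≟ᵉ_ : ∀ {n} → DecidableEquality (Edge n)
edge i j _ ≟ᵉ edge i′ j′ _ with i ≟ᶠ i′ | j ≟ᶠ j′
... | yes refl | yes refl = yes refl
... | no i≢i′  | _        = no λ { refl → i≢i′ refl }
... | yes _    | no j≢j′  = no λ { refl → j≢j′ refl }

-- The complete 3-vertex subgraphs of K_n.

record Triangle (n : ℕ) : Set where
  constructor triangle
  field
    i j k : Fin n
    .i<j  : i < j
    .j<k  : j < k

ij ik jk : ∀ {n} → Triangle n → Edge n
ij (triangle i j k i<j j<k) = edge i j i<j
ik (triangle i j k i<j j<k) = edge i k (<-trans i<j j<k)
jk (triangle i j k i<j j<k) = edge j k j<k

infix 4 _∋_ _∋?_

_∋_ : ∀ {n} → Triangle n → Edge n → Set
H ∋ e = e ≡ ij H ⊎ e ≡ ik H ⊎ e ≡ jk H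

_∋?_ : ∀ {n} (H : Triangle n) (e : Edge n) → Dec (H ∋ e)
H ∋? e = (e ≟ᵉ ij H) ⊎-dec (e ≟ᵉ ik H) ⊎-dec (e ≟ᵉ jk H)

-- A simple graph with vertex set Fin n, given by its set of edges.

Graph : ℕ → Set
Graph n = Edge n → Bool

_⊆ᵗ_ : ∀ {n} → Triangle n → Graph n → Set
H ⊆ᵗ G = T (G (ij H)) × T (G (ik H)) × T (G (jk H))

_⊆ᵗ?_ : ∀ {n} (H : Triangle n) (G : Graph n) → Dec (H ⊆ᵗ G)
H ⊆ᵗ? G = T? (G (ij H)) ×-dec T? (G (ik H)) ×-dec T? (G (jk H))

record TriangleOf {n : ℕ} (G : Graph n) : Set where
  constructor triangleOf
  field
    H    : Triangle n
    .H⊆G : H ⊆ᵗ G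

data Colour : Set where
  red blue : Colour

Colouring : ℕ → Set
Colouring n = Edge n → Colour

hasColour : Colour → Colour → Bool
hasColour red  red  = true
hasColour blue blue = true
hasColour _    _    = false

colourClass : ∀ {n} → Colouring n → Colour → Graph n
colourClass c x e = hasColour x (c e)

module _ (ℝ : Reals) where
  open Reals ℝ

  sumIf : {P : Set} → Dec P → (.P → Carrier) → Carrier
  sumIf (yes p) f = f p
  sumIf (no  _) f = 0#

  sumEdges : ∀ {n} → (Edge n → Carrier) → Carrier
  sumEdges w =
    sum λ i → sum λ j → sumIf (i <? j) λ i<j → w (edge i j i<j)

  sumTriangles : ∀ {n} → (Triangle n → Carrier) → Carrier
  sumTriangles f =
    sum λ i → sum λ j → sum λ k →
      sumIf (i <? j) λ i<j → sumIf (j <? k) λ j<k → f (triangle i j k i<j j<k)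

  sumTrianglesOf : ∀ {n} (G : Graph n) → (TriangleOf G → Carrier) → Carrier
  sumTrianglesOf G g =
    sumTriangles λ H → sumIf (H ⊆ᵗ? G) λ H⊆G → g (triangleOf H H⊆G)

  record IsWeighting {n : ℕ} (w : Edge n → Carrier) : Set where
    field
      nonNegative : ∀ e → 0# ≤ w e
      total       : sumEdges w ≈ fromℕ (n C 2)

  -- The sum of the weights on the edges of H that have colour x.

  colourWeight : ∀ {n} → (Edge n → Carrier) → Colouring n → Triangle n →
                 Colour → Carrier
  colourWeight w c H x = part (ij H) + part (ik H) + part (jk H)
    where
    part : Edge _ → Carrier
    part e = if colourClass c x e then w e else 0#

  Is-wR : ℕ → Carrier → Set
  Is-wR n = IsMinimum λ q →
    ∃[ w ] ∃[ c ] (IsWeighting {n} w × (∀ H x → colourWeight w c H x ≤ q))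

  -- K_n has a complete 3-vertex subgraph only for n ≥ 3, so wR(n,3) is
  -- constrained only there.

  Is-𝐖 : Carrier → Set
  Is-𝐖 W =
    Σ[ wR ∈ (ℕ → Carrier) ] ((∀ n → 3 ℕ.≤ n → Is-wR n (wR n)) × IsLimit wR W)

  record IsFractionalPacking {n : ℕ} (G : Graph n) (g : TriangleOf G → Carrier)
         : Set where
    field
      nonNegative : ∀ H → 0# ≤ g H
      capacity    : ∀ e → T (G e) →
        sumTrianglesOf G (λ H → sumIf (TriangleOf.H H ∋? e) λ _ → g H) ≤ 1#

  Is-τ* : ∀ {n} → Graph n → Carrier → Set
  Is-τ* G = IsMaximum λ t →
    ∃[ g ] (IsFractionalPacking G g × t ≈ sumTrianglesOf G g)

  Is-τ*ₙ : ℕ → Carrier → Set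
  Is-τ*ₙ n = IsMinimum λ t →
    Σ[ c ∈ Colouring n ] ∃[ r ] ∃[ b ]
      (Is-τ* (colourClass c red) r × Is-τ* (colourClass c blue) b × t ≈ r + b)

  -- The terms with n < 2 divide by zero; they do not affect the limit.

  Is-τ*∞ : Carrier → Set
  Is-τ*∞ t =
    Σ[ τ*ₙ ∈ (ℕ → Carrier) ]
      ((∀ n → Is-τ*ₙ n (τ*ₙ n)) × IsLimit (λ n → τ*ₙ n / fromℕ (n C 2)) t)

{-# OPTIONS --safe #-}
module Submission where

-- For a colouring c, maximising the total weight under w(H) ≤ 1 for each
-- colour part of each triangle H is dual to covering the edges by such parts.
-- Concretely, a fractional triangle cover y of the red and of the blue graph
-- gives the weights max(0, 1 - y), of at most 2 on each colour part, and
-- conversely weights w bounded by q give the cover max(0, 1 - 2w / q), whose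
-- total is (1 - 2 / q) (n C 2) up to the contribution of the edges with 2w > q,
-- of which each vertex meets at most one per colour.  By LP duality
-- the covers have the same optimal value as the packings, so that
-- wR(n,3) (1 - τ*(n,3) / (n C 2)) = 2 + O(1/n).
--
-- Decidability of the order makes all the (in)equalities concerned stable
-- under double negation, which is where classical reasoning takes place.

open import Defs
open import Algebra.Bundles using (CommutativeRing)
open import Algebra.Solver.Ring.AlmostCommutativeRing
  using (fromCommutativeRing; _-Raw-AlmostCommutative⟶_)
open import Data.Bool.Base using (T; true; false; if_then_else_)
open import Data.Bool.Properties using (T?)
open import Data.Empty using (⊥; ⊥-elim; ⊥-elim-irr)
open import Data.Fin.Base as Fin using (Fin; zero; suc)
open import Data.Fin.Properties using (_<?_; <-irrefl)
  renaming (_≟_ to _≟ᶠ_; suc-injective to suc-injectiveᶠ)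
open import Data.Integer.Base as ℤ using (ℤ; +_; -[1+_]; _⊖_; _◃_)
open import Data.List.Base using (List; []; _∷_; [_]; _++_; concat; map; tabulate)
open import Data.List.Membership.DecPropositional using (_∈?_)
open import Data.List.Membership.Propositional using (_∈_)
open import Data.List.Membership.Propositional.Properties using (∈-++⁺ˡ; ∈-++⁺ʳ; ∈-map⁺)
open import Data.List.Relation.Unary.Any using (here; there)
open import Data.Maybe.Base using (Maybe; just; nothing)
open import Data.Nat.Base as ℕ using (ℕ; zero; suc; _⊔_)
open import Data.Nat.Combinatorics using (_C_; nC1≡n; nCk+nC[k+1]≡[n+1]C[k+1])
open import Data.Product.Base using (∃-syntax; _×_; _,_; proj₁; proj₂)
open import Data.Sum.Base using (_⊎_; inj₁; inj₂)
open import Function.Base using (_∘_)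
open import Relation.Binary.Definitions using (DecidableEquality)
open import Relation.Binary.PropositionalEquality.Core as ≡ using (_≡_; _≢_)
open import Relation.Binary.PropositionalEquality.Properties using (module ≡-Reasoning)
open import Relation.Binary.Structures using (IsDecTotalOrder)
open import Relation.Nullary using (¬_; Dec; yes; no)
open import Relation.Nullary.Decidable
  using (_⊎-dec_; decidable-stable; recompute; ¬¬-excluded-middle)

import Algebra.Properties.AbelianGroup
import Algebra.Properties.CommutativeMonoid.Sum
import Algebra.Properties.Ring
import Algebra.Properties.Semiring.Mult.TCOptimised
import Algebra.Solver.Ring
import Data.Integer.Properties as ℤ
import Data.Nat.Properties as ℕ
import Data.Nat.Solver
import Data.Sign.Base as Sign
import Relation.Binary.Reasoning.Setoid

-- Both constants come from counting on a monochromatic triangle: its three edges carry cover at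
-- least 1, which leaves at most 3 - 1 = 2 for the weights `1 - y`; and weight at most q leaves at
-- least 3 - 2 = 1 for the cover `1 - 2w / q`. The packing maxima are not given to exist, yet the
-- minimum defining τ*(n,3) compares only colourings for which they do. Attainment is therefore
-- proved, with Farkas' lemma in place of compactness: below a supremum that is not attained there
-- would lie the total of a cover. In the other direction no optimal cover is needed, because one
-- within 1 of the optimum loses only a constant, which vanishes against n C 2. The bounds at finite
-- n are kept as products, since neither q nor 1 - τ* is known to be nonzero; that 1 - τ*(3) is
-- nonzero comes out at the end, from its product with W being 2.

-- Ring solver with integer coefficients

module IntegerCoefficients {c ℓ} (R : CommutativeRing c ℓ) where
  open CommutativeRing R
  open Algebra.Properties.Ring ring
  open Algebra.Properties.AbelianGroup +-abelianGroup using (⁻¹-∙-comm)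
  open Algebra.Properties.Semiring.Mult.TCOptimised semiring renaming (_×_ to _·_)
  open Relation.Binary.Reasoning.Setoid setoid

  -- With the optimised multiple, `fromℤ (+ 1)` computes to `1#`, so that `one` in a solver equation
  -- matches a literal `1#` in the goal.
  fromℤ : ℤ → Carrier
  fromℤ (+ n)    = n · 1#
  fromℤ -[1+ n ] = - (suc n · 1#)

  fromℤ-⊖ : ∀ m n → fromℤ (m ⊖ n) ≈ m · 1# - n · 1#
  fromℤ-⊖ zero    zero    = sym (-‿inverseʳ 0#)
  fromℤ-⊖ zero    (suc n) = sym (+-identityˡ _)
  fromℤ-⊖ (suc m) zero    = sym (trans (+-congˡ -0#≈0#) (+-identityʳ _))
  fromℤ-⊖ (suc m) (suc n) = begin
    fromℤ (suc m ⊖ suc n)                     ≡⟨ ≡.cong fromℤ (ℤ.[1+m]⊖[1+n]≡m⊖n m n) ⟩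
    fromℤ (m ⊖ n)                             ≈⟨ fromℤ-⊖ m n ⟩
    m · 1# - n · 1#                           ≈⟨ +-congʳ (+-identityʳ _) ⟨
    m · 1# + 0# - n · 1#                      ≈⟨ +-congʳ (+-congˡ (-‿inverseʳ 1#)) ⟨
    m · 1# + (1# - 1#) - n · 1#               ≈⟨ +-congʳ (+-assoc _ _ _) ⟨
    m · 1# + 1# - 1# - n · 1#                 ≈⟨ +-assoc _ _ _ ⟩
    m · 1# + 1# + (- 1# - n · 1#)             ≈⟨ +-cong (sym (1+ m)) (⁻¹-∙-comm _ _) ⟩
    suc m · 1# - (1# + n · 1#)                ≈⟨ +-congˡ (-‿cong (×-homo-+ 1# 1 n)) ⟨
    suc m · 1# - suc n · 1#                   ∎
    where
    1+ : ∀ m → suc m · 1# ≈ m · 1# + 1#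
    1+ m = trans (×-homo-+ 1# 1 m) (+-comm _ _)

  fromℤ-neg : ∀ i → fromℤ (ℤ.- i) ≈ - fromℤ i
  fromℤ-neg (+ zero)  = sym -0#≈0#
  fromℤ-neg (+ suc n) = refl
  fromℤ-neg -[1+ n ]  = sym (-‿involutive _)

  fromℤ-+ : ∀ i j → fromℤ (i ℤ.+ j) ≈ fromℤ i + fromℤ j
  fromℤ-+ (+ m)    (+ n)    = ×-homo-+ 1# m n
  fromℤ-+ (+ m)    -[1+ n ] = fromℤ-⊖ m (suc n)
  fromℤ-+ -[1+ m ] (+ n)    = trans (fromℤ-⊖ n (suc m)) (+-comm _ _)
  fromℤ-+ -[1+ m ] -[1+ n ] = begin
    - (suc (suc (m ℕ.+ n)) · 1#)        ≡⟨ ≡.cong (λ k → - (suc k · 1#)) (ℕ.+-suc m n) ⟨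
    - ((suc m ℕ.+ suc n) · 1#)          ≈⟨ -‿cong (×-homo-+ 1# (suc m) (suc n)) ⟩
    - (suc m · 1# + suc n · 1#)         ≈⟨ ⁻¹-∙-comm _ _ ⟨
    - (suc m · 1#) - suc n · 1#         ∎

  fromℤ-* : ∀ i j → fromℤ (i ℤ.* j) ≈ fromℤ i * fromℤ j
  fromℤ-* (+ m) (+ n) = begin
    fromℤ (Sign.+ ◃ m ℕ.* n)   ≡⟨ ≡.cong fromℤ (ℤ.+◃n≡+n (m ℕ.* n)) ⟩
    (m ℕ.* n) · 1#             ≈⟨ ×1-homo-* m n ⟩
    m · 1# * (n · 1#)          ∎
  fromℤ-* (+ m) -[1+ n ] = begin
    fromℤ (Sign.- ◃ m ℕ.* suc n)   ≡⟨ ≡.cong fromℤ (ℤ.-◃n≡-n (m ℕ.* suc n)) ⟩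
    fromℤ (ℤ.- + (m ℕ.* suc n))    ≈⟨ fromℤ-neg (+ (m ℕ.* suc n)) ⟩
    - ((m ℕ.* suc n) · 1#)         ≈⟨ -‿cong (×1-homo-* m (suc n)) ⟩
    - (m · 1# * (suc n · 1#))      ≈⟨ -‿distribʳ-* _ _ ⟩
    m · 1# * - (suc n · 1#)        ∎
  fromℤ-* -[1+ m ] (+ n) = begin
    fromℤ (Sign.- ◃ suc m ℕ.* n)   ≡⟨ ≡.cong fromℤ (ℤ.-◃n≡-n (suc m ℕ.* n)) ⟩
    fromℤ (ℤ.- + (suc m ℕ.* n))    ≈⟨ fromℤ-neg (+ (suc m ℕ.* n)) ⟩
    - ((suc m ℕ.* n) · 1#)         ≈⟨ -‿cong (×1-homo-* (suc m) n) ⟩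
    - (suc m · 1# * (n · 1#))      ≈⟨ -‿distribˡ-* _ _ ⟩
    - (suc m · 1#) * (n · 1#)      ∎
  fromℤ-* -[1+ m ] -[1+ n ] = begin
    (suc m ℕ.* suc n) · 1#              ≈⟨ ×1-homo-* (suc m) (suc n) ⟩
    suc m · 1# * (suc n · 1#)           ≈⟨ -‿involutive _ ⟨
    - - (suc m · 1# * (suc n · 1#))     ≈⟨ -‿cong (-‿distribˡ-* _ _) ⟩
    - (- (suc m · 1#) * (suc n · 1#))   ≈⟨ -‿distribʳ-* _ _ ⟩
    - (suc m · 1#) * - (suc n · 1#)     ∎

  fromℤ-homomorphism :
    CommutativeRing.rawRing ℤ.+-*-commutativeRing -Raw-AlmostCommutative⟶ fromCommutativeRing R
  fromℤ-homomorphism = record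
    { ⟦_⟧    = fromℤ
    ; +-homo = fromℤ-+
    ; *-homo = fromℤ-*
    ; -‿homo = fromℤ-neg
    ; 0-homo = refl
    ; 1-homo = refl
    }

  fromℤ-≟ : ∀ i j → Maybe (fromℤ i ≈ fromℤ j)
  fromℤ-≟ i j with i ℤ.≟ j
  ... | yes ≡.refl = just refl
  ... | no _       = nothing

  open Algebra.Solver.Ring _ _ fromℤ-homomorphism fromℤ-≟ public

  infix 4 _⊜_
  _⊜_ : ∀ {n} → Polynomial n → Polynomial n → Polynomial n × Polynomial n
  _⊜_ = _,_

  one two : ∀ {n} → Polynomial n
  one = con (+ 1)
  two = one :+ one
  nil : ∀ {n} → Polynomial n
  nil = con (+ 0)

-- Arithmetic of the complete ordered field

module OrderedField (ℝ : Reals) where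
  open Reals ℝ hiding (zero)
  open IsDecTotalOrder isDecTotalOrder public using (_≟_; _≤?_; total)
    renaming (refl to ≤-refl; reflexive to ≤-reflexive; trans to ≤-trans; antisym to ≤-antisym)
  open IntegerCoefficients commutativeRing public

  infix 4 _<_
  _<_ : Carrier → Carrier → Set
  x < y = ¬ (y ≤ x)

  ≤-stable : ∀ {x y} → ¬ ¬ (x ≤ y) → x ≤ y
  ≤-stable = decidable-stable (_ ≤? _)

  <⇒≤ : ∀ {x y} → x < y → x ≤ y
  <⇒≤ {x} {y} x<y with total x y
  ... | inj₁ x≤y = x≤y
  ... | inj₂ y≤x = ⊥-elim (x<y y≤x)

  <⇒<ᵣ : ∀ {x y} → x < y → x <ᵣ y
  <⇒<ᵣ x<y = <⇒≤ x<y , λ x≈y → x<y (≤-reflexive (sym x≈y))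

  -- An inequality is certified by writing the difference of its sides as a
  -- polynomial in nonnegative quantities; the equation is a ring identity.
  certify : ∀ {x y p} → 0# ≤ p → y ≈ x + p → x ≤ y
  certify {x} {y} {p} 0≤p y≈x+p =
    ≤-trans (≤-reflexive (sym (+-identityˡ x)))
      (≤-trans (+-monoˡ-≤ x 0≤p)
        (≤-reflexive (trans (+-comm p x) (sym y≈x+p))))

  gap : ∀ {x y} → x ≤ y → 0# ≤ y - x
  gap {x} x≤y = ≤-trans (≤-reflexive (sym (-‿inverseʳ x))) (+-monoˡ-≤ (- x) x≤y)

  gap⁻¹ : ∀ {x y} → 0# ≤ y - x → x ≤ y
  gap⁻¹ {x} {y} 0≤y-x = certify 0≤y-x (solve 2 (λ x y → y ⊜ x :+ (y :- x)) refl x y)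

  +-nonneg : ∀ {x y} → 0# ≤ x → 0# ≤ y → 0# ≤ x + y
  +-nonneg {x} {y} 0≤x 0≤y =
    ≤-trans 0≤y (certify 0≤x (+-comm x y))

  +-mono-≤ : ∀ {x y u v} → x ≤ y → u ≤ v → x + u ≤ y + v
  +-mono-≤ {x} {y} {u} {v} x≤y u≤v = certify (+-nonneg (gap x≤y) (gap u≤v))
    (solve 4 (λ x y u v → y :+ v ⊜ x :+ u :+ (y :- x :+ (v :- u))) refl x y u v)

  *-monoˡ-≤ : ∀ {x y z} → 0# ≤ z → x ≤ y → z * x ≤ z * y
  *-monoˡ-≤ {x} {y} {z} 0≤z x≤y = certify (*-nonNegative 0≤z (gap x≤y))
    (solve 3 (λ x y z → z :* y ⊜ z :* x :+ z :* (y :- x)) refl x y z)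

  0≤1 : 0# ≤ 1#
  0≤1 with total 0# 1#
  ... | inj₁ 0≤1 = 0≤1
  ... | inj₂ 1≤0 = ≤-trans (*-nonNegative (gap 1≤0) (gap 1≤0))
    (≤-reflexive (solve 0 ((nil :- one) :* (nil :- one) ⊜ one) refl))

  0≤2 : 0# ≤ 1# + 1#
  0≤2 = +-nonneg 0≤1 0≤1

  0<1 : 0# < 1#
  0<1 1≤0 = 1≉0 (≤-antisym 1≤0 0≤1)

  0<⇒≉ : ∀ {x} → 0# < x → x ≉ 0#
  0<⇒≉ 0<x x≈0 = 0<x (≤-reflexive x≈0)

  <-≤-trans : ∀ {x y z} → x < y → y ≤ z → x < z
  <-≤-trans x<y y≤z z≤x = x<y (≤-trans y≤z z≤x)

  +-pos : ∀ {x y} → 0# < x → 0# ≤ y → 0# < x + y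
  +-pos {x} {y} 0<x 0≤y = <-≤-trans 0<x (certify 0≤y refl)

  0<2 : 0# < 1# + 1#
  0<2 = +-pos 0<1 0≤1

  x-1<x : ∀ x → x - 1# < x
  x-1<x x x≤x-1 = 0<1 (gap⁻¹ (≤-trans (gap x≤x-1)
    (≤-reflexive (solve 1 (λ x → x :- one :- x ⊜ nil :- one) refl x))))

  module _ {x} (0<x : 0# < x) where

    inverse : x * x ⁻¹ ≈ 1#
    inverse = ⁻¹-inverseʳ x (0<⇒≉ 0<x)

    ⁻¹-nonneg : 0# ≤ x ⁻¹
    ⁻¹-nonneg with total 0# (x ⁻¹)
    ... | inj₁ 0≤x⁻¹ = 0≤x⁻¹
    ... | inj₂ x⁻¹≤0 = ⊥-elim (0<1 (gap⁻¹ (≤-trans (*-nonNegative (<⇒≤ 0<x) (gap x⁻¹≤0))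
      (≤-reflexive (trans (solve 2 (λ x y → x :* (nil :- y) ⊜ nil :- x :* y) refl x (x ⁻¹))
        (+-congˡ (-‿cong inverse)))))))

    *-cancelˡ-≤ : ∀ {a b} → x * a ≤ x * b → a ≤ b
    *-cancelˡ-≤ {a} {b} xa≤xb = certify (*-nonNegative ⁻¹-nonneg (gap xa≤xb))
      (sym (trans (solve 4 (λ a b x y → a :+ y :* (x :* b :- x :* a) ⊜ a :+ x :* y :* (b :- a))
                     refl a b x (x ⁻¹))
           (trans (+-congˡ (*-congʳ inverse))
             (solve 2 (λ a b → a :+ one :* (b :- a) ⊜ b) refl a b))))

    *-pos : ∀ {y} → 0# < y → 0# < x * y
    *-pos 0<y xy≤0 = 0<y (*-cancelˡ-≤ (≤-trans xy≤0 (≤-reflexive (sym (zeroʳ x)))))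

    *-/-cancel : ∀ a → x * (a / x) ≈ a
    *-/-cancel a = trans (solve 3 (λ a x y → x :* (a :* y) ⊜ x :* y :* a) refl a x (x ⁻¹))
      (trans (*-congʳ inverse) (*-identityˡ a))

    /-nonneg : ∀ {a} → 0# ≤ a → 0# ≤ a / x
    /-nonneg 0≤a = *-nonNegative 0≤a ⁻¹-nonneg

    /-pos : ∀ {a} → 0# < a → 0# < a / x
    /-pos {a} 0<a a/x≤0 = 0<a (≤-trans (≤-reflexive (sym (*-/-cancel a)))
      (≤-trans (*-monoˡ-≤ (<⇒≤ 0<x) a/x≤0) (≤-reflexive (zeroʳ x))))

  posPart : Carrier → Carrier
  posPart x with x ≤? 0#
  ... | yes _ = 0#
  ... | no _  = x

  0≤posPart : ∀ x → 0# ≤ posPart x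
  0≤posPart x with x ≤? 0#
  ... | yes _  = ≤-refl
  ... | no x≰0 = <⇒≤ x≰0

  x≤posPart : ∀ x → x ≤ posPart x
  x≤posPart x with x ≤? 0#
  ... | yes x≤0 = x≤0
  ... | no _    = ≤-refl

  posPart-lub : ∀ {x z} → 0# ≤ z → x ≤ z → posPart x ≤ z
  posPart-lub {x} 0≤z x≤z with x ≤? 0#
  ... | yes _ = 0≤z
  ... | no _  = x≤z

  posPart-zero : ∀ {x} → x ≤ 0# → posPart x ≈ 0#
  posPart-zero {x} x≤0 with x ≤? 0#
  ... | yes _  = refl
  ... | no x≰0 = ⊥-elim (x≰0 x≤0)

  fromℕ-nonneg : ∀ n → 0# ≤ fromℕ n
  fromℕ-nonneg zero    = ≤-refl
  fromℕ-nonneg (suc n) = +-nonneg 0≤1 (fromℕ-nonneg n)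

  fromℕ-+ : ∀ m n → fromℕ (m ℕ.+ n) ≈ fromℕ m + fromℕ n
  fromℕ-+ zero    n = sym (+-identityˡ _)
  fromℕ-+ (suc m) n = trans (+-congˡ (fromℕ-+ m n)) (sym (+-assoc _ _ _))

  fromℕ-* : ∀ m n → fromℕ (m ℕ.* n) ≈ fromℕ m * fromℕ n
  fromℕ-* zero    n = sym (zeroˡ _)
  fromℕ-* (suc m) n = trans (fromℕ-+ n (m ℕ.* n)) (trans (+-congˡ (fromℕ-* m n))
    (solve 2 (λ m n → n :+ m :* n ⊜ (one :+ m) :* n) refl (fromℕ m) (fromℕ n)))

  fromℕ-mono : ∀ {m n} → m ℕ.≤ n → fromℕ m ≤ fromℕ n
  fromℕ-mono {n = n} ℕ.z≤n = fromℕ-nonneg n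
  fromℕ-mono (ℕ.s≤s m≤n)   = +-mono-≤ ≤-refl (fromℕ-mono m≤n)

  -- Otherwise the naturals would be bounded by `x` and have a supremum `s`; as every successor is
  -- at most `s`, already `s - 1#` would be an upper bound.
  archimedean : ∀ x → ¬ ¬ (∃[ n ] x ≤ fromℕ n)
  archimedean x unbounded = x-1<x s (least (s - 1#) λ y (n , y≈n) →
      ≤-trans (≤-reflexive y≈n) (gap⁻¹ (≤-trans (gap (upper _ (suc n , refl)))
        (≤-reflexive (solve 2 (λ s n → s :- (one :+ n) ⊜ s :- one :- n) refl s (fromℕ n))))))
    where
    IsNatural : Carrier → Set
    IsNatural y = ∃[ n ] y ≈ fromℕ n

    below-x : UpperBound IsNatural x
    below-x y (n , y≈n) = ≤-trans (≤-reflexive y≈n) (<⇒≤ λ x≤n → unbounded (n , x≤n))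

    lub = supremum IsNatural (0# , 0 , refl) (x , below-x)
    s = proj₁ lub
    upper = proj₁ (proj₂ lub)
    least = proj₂ (proj₂ lub)

  ≤-from-ε : ∀ {x y k} → 0# ≤ k →
             (∀ ε → 0# < ε → ε ≤ 1# → x ≤ y + k * ε) → x ≤ y
  ≤-from-ε {x} {y} {k} 0≤k bound = ≤-stable λ x≰y →
    let d   = x - y
        0<d : 0# < d
        0<d d≤0 = x≰y (certify (gap d≤0)
          (solve 2 (λ x y → y ⊜ x :+ (nil :- (x :- y))) refl x y))
        -- With this denominator `ε` is at most 1 and `d ≈ (d + k + 1) ε`; together with `d ≤ k ε`
        -- this leaves `(d + 1) ε ≤ 0`, which is absurd.
        m   = d + (k + 1#)
        0<m : 0# < m
        0<m = +-pos 0<d (+-nonneg 0≤k 0≤1)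
        ε   = d / m
        mε≈d = *-/-cancel 0<m d
        0<ε = /-pos 0<m 0<d
        ε≤1 : ε ≤ 1#
        ε≤1 = *-cancelˡ-≤ 0<m (≤-trans (≤-reflexive mε≈d)
          (certify (+-nonneg 0≤k 0≤1) (*-identityʳ m)))
        d≤kε : d ≤ k * ε
        d≤kε = certify (gap (bound ε 0<ε ε≤1))
          (solve 4 (λ x y k e → k :* e ⊜ x :- y :+ (y :+ k :* e :- x)) refl x y k ε)
    in *-pos 0<ε (+-pos 0<d 0≤1) (gap⁻¹ (≤-trans (gap (≤-trans (≤-reflexive mε≈d) d≤kε))
         (≤-reflexive (solve 3 (λ d k e → k :* e :- (d :+ (k :+ one)) :* e ⊜ nil :- e :* (d :+ one))
           refl d k ε))))

-- Finite sums over edges and triangles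

-- The counterpart of `sumIf` for lists. `allEdges` and `trianglesOf` nest it as the sums nest
-- `sumIf`, so that each sum turns into a list sum layer by layer.
cond : {A P : Set} → Dec P → (.P → List A) → List A
cond (yes p) l = l p
cond (no _)  l = []

_≟ᵗ_ : ∀ {n} → DecidableEquality (Triangle n)
triangle i j k _ _ ≟ᵗ triangle i′ j′ k′ _ _ with i ≟ᶠ i′ | j ≟ᶠ j′ | k ≟ᶠ k′
... | yes ≡.refl | yes ≡.refl | yes ≡.refl = yes ≡.refl
... | no i≢i′    | _          | _          = no λ { ≡.refl → i≢i′ ≡.refl }
... | yes _      | no j≢j′    | _          = no λ { ≡.refl → j≢j′ ≡.refl }
... | yes _      | yes _      | no k≢k′    = no λ { ≡.refl → k≢k′ ≡.refl }

_≟ᵍ_ : ∀ {n} {G : Graph n} → DecidableEquality (TriangleOf G)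
triangleOf H _ ≟ᵍ triangleOf H′ _ with H ≟ᵗ H′
... | yes ≡.refl = yes ≡.refl
... | no H≢H′    = no λ { ≡.refl → H≢H′ ≡.refl }

allEdges : ∀ n → List (Edge n)
allEdges n = concat (tabulate {n = n} λ i → concat (tabulate {n = n} λ j →
  cond (i <? j) λ i<j → [ edge i j i<j ]))

trianglesOf : ∀ {n} (G : Graph n) → List (TriangleOf G)
trianglesOf {n} G =
  concat (tabulate {n = n} λ i → concat (tabulate {n = n} λ j → concat (tabulate {n = n} λ k →
    cond (i <? j) λ i<j → cond (j <? k) λ j<k →
    cond (triangle i j k i<j j<k ⊆ᵗ? G) λ H⊆G → [ triangleOf (triangle i j k i<j j<k) H⊆G ])))

module FiniteSums (ℝ : Reals) where
  open Reals ℝ hiding (zero)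
  open OrderedField ℝ

  Σᴸ : {A : Set} → List A → (A → Carrier) → Carrier
  Σᴸ []       f = 0#
  Σᴸ (a ∷ as) f = f a + Σᴸ as f

  module _ {A : Set} where

    Σᴸ-++ : ∀ as bs (f : A → Carrier) → Σᴸ (as ++ bs) f ≈ Σᴸ as f + Σᴸ bs f
    Σᴸ-++ []       bs f = sym (+-identityˡ _)
    Σᴸ-++ (a ∷ as) bs f = trans (+-congˡ (Σᴸ-++ as bs f)) (sym (+-assoc _ _ _))

    Σᴸ-cong : ∀ as {f g : A → Carrier} → (∀ a → f a ≈ g a) → Σᴸ as f ≈ Σᴸ as g
    Σᴸ-cong []       f≈g = refl
    Σᴸ-cong (a ∷ as) f≈g = +-cong (f≈g a) (Σᴸ-cong as f≈g)

    Σᴸ-mono : ∀ as {f g : A → Carrier} → (∀ a → f a ≤ g a) → Σᴸ as f ≤ Σᴸ as g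
    Σᴸ-mono []       f≤g = ≤-refl
    Σᴸ-mono (a ∷ as) f≤g = +-mono-≤ (f≤g a) (Σᴸ-mono as f≤g)

    Σᴸ-linear : ∀ as x y (f g : A → Carrier) →
                Σᴸ as (λ a → x * f a + y * g a) ≈ x * Σᴸ as f + y * Σᴸ as g
    Σᴸ-linear []       x y f g = solve 2 (λ x y → nil ⊜ x :* nil :+ y :* nil) refl x y
    Σᴸ-linear (a ∷ as) x y f g = trans (+-congˡ (Σᴸ-linear as x y f g))
      (solve 6 (λ x y u v s t → x :* u :+ y :* v :+ (x :* s :+ y :* t) ⊜
                                x :* (u :+ s) :+ y :* (v :+ t))
        refl x y (f a) (g a) (Σᴸ as f) (Σᴸ as g))

    Σᴸ-zero : ∀ as → Σᴸ {A} as (λ _ → 0#) ≈ 0#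
    Σᴸ-zero []       = refl
    Σᴸ-zero (a ∷ as) = trans (+-identityˡ _) (Σᴸ-zero as)

  sum-zero : ∀ n {f : Fin n → Carrier} → (∀ i → f i ≈ 0#) → sum f ≈ 0#
  sum-zero zero    f≈0 = refl
  sum-zero (suc n) f≈0 = trans (+-cong (f≈0 zero) (sum-zero n (f≈0 ∘ suc))) (+-identityˡ _)

  sum-single : ∀ {n} i (f : Fin n → Carrier) → (∀ j → j ≢ i → f j ≈ 0#) → sum f ≈ f i
  sum-single zero    f f≈0 =
    trans (+-congˡ (sum-zero _ λ j → f≈0 (suc j) λ ())) (+-identityʳ _)
  sum-single (suc i) f f≈0 =
    trans (+-cong (f≈0 zero λ ()) (sum-single i (f ∘ suc) λ j j≢i → f≈0 (suc j) (j≢i ∘ suc-injectiveᶠ)))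
          (+-identityˡ _)

  sumIf-yes : {P : Set} (P? : Dec P) (f : .P → Carrier) .(p : P) → sumIf ℝ P? f ≈ f p
  sumIf-yes (yes _) f p = refl
  sumIf-yes (no ¬p) f p = ⊥-elim-irr (¬p p)

  sumIf-zero : {P : Set} (P? : Dec P) {f : .P → Carrier} → (∀ .p → f p ≈ 0#) → sumIf ℝ P? f ≈ 0#
  sumIf-zero (yes p) f≈0 = f≈0 p
  sumIf-zero (no _)  f≈0 = refl

  sum-list : {A : Set} (f : A → Carrier) → ∀ n {g : Fin n → Carrier} {l : Fin n → List A} →
             (∀ i → g i ≈ Σᴸ (l i) f) → sum g ≈ Σᴸ (concat (tabulate l)) f
  sum-list f zero    g≈ = refl
  sum-list f (suc n) {l = l} g≈ =
    trans (+-cong (g≈ zero) (sum-list f n (g≈ ∘ suc))) (sym (Σᴸ-++ (l zero) _ f))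

  sumIf-list : {A P : Set} (f : A → Carrier) (P? : Dec P) {g : .P → Carrier} {l : .P → List A} →
               (∀ .p → g p ≈ Σᴸ (l p) f) → sumIf ℝ P? g ≈ Σᴸ (cond P? l) f
  sumIf-list f (yes p) g≈ = g≈ p
  sumIf-list f (no _)  g≈ = refl

  -- `asList` gives linearity and monotonicity. `single` expresses, through `S` alone, that each
  -- element is counted exactly once.
  record IsSummation {A : Set} (S : (A → Carrier) → Carrier) : Set where
    field
      list   : List A
      asList : ∀ f → S f ≈ Σᴸ list f
      single : ∀ a f → (∀ b → b ≢ a → f b ≈ 0#) → S f ≈ f a

    S-cong : ∀ {f g} → (∀ a → f a ≈ g a) → S f ≈ S g
    S-cong f≈g = trans (asList _) (trans (Σᴸ-cong list f≈g) (sym (asList _)))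

    S-mono : ∀ {f g} → (∀ a → f a ≤ g a) → S f ≤ S g
    S-mono f≤g = ≤-trans (≤-reflexive (asList _))
      (≤-trans (Σᴸ-mono list f≤g) (≤-reflexive (sym (asList _))))

    S-linear : ∀ x y f g → S (λ a → x * f a + y * g a) ≈ x * S f + y * S g
    S-linear x y f g = trans (asList _) (trans (Σᴸ-linear list x y f g)
      (sym (+-cong (*-congˡ (asList f)) (*-congˡ (asList g)))))

    S-zero : ∀ {f} → (∀ a → f a ≈ 0#) → S f ≈ 0#
    S-zero f≈0 = trans (asList _) (trans (Σᴸ-cong list f≈0) (Σᴸ-zero list))

    S-nonneg : ∀ {f} → (∀ a → 0# ≤ f a) → 0# ≤ S f
    S-nonneg 0≤f = ≤-trans (≤-reflexive (sym (S-zero λ _ → refl))) (S-mono 0≤f)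

    S-* : ∀ x f → S (λ a → x * f a) ≈ x * S f
    S-* x f = trans (S-cong λ a → solve 2 (λ x u → x :* u ⊜ x :* u :+ nil :* u) refl x (f a))
      (trans (S-linear x 0# f f) (solve 2 (λ x u → x :* u :+ nil :* u ⊜ x :* u) refl x (S f)))

    S-+ : ∀ f g → S (λ a → f a + g a) ≈ S f + S g
    S-+ f g = trans (S-cong λ a → solve 2 (λ u v → u :+ v ⊜ one :* u :+ one :* v) refl (f a) (g a))
      (trans (S-linear 1# 1# f g)
        (solve 2 (λ u v → one :* u :+ one :* v ⊜ u :+ v) refl (S f) (S g)))

    -- The indicator of an element missing from `list` would sum to 0 along the list, but to 1 by
    -- `single`.
    ∈-list : DecidableEquality A → ∀ a → a ∈ list
    ∈-list _≟ᴬ_ a with _∈?_ _≟ᴬ_ a list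
    ... | yes a∈ = a∈
    ... | no a∉  = ⊥-elim (1≉0 (trans (sym δ-self) (trans (sym (single a δ δ-other))
                     (trans (asList δ) (Σᴸ-δ list a∉)))))
      where
      δ : A → Carrier
      δ b = sumIf ℝ (b ≟ᴬ a) λ _ → 1#

      δ-self : δ a ≈ 1#
      δ-self = sumIf-yes (a ≟ᴬ a) (λ _ → 1#) ≡.refl

      δ-other : ∀ b → b ≢ a → δ b ≈ 0#
      δ-other b b≢a = sumIf-zero (b ≟ᴬ a) λ b≡a → ⊥-elim-irr (b≢a b≡a)

      Σᴸ-δ : ∀ as → ¬ a ∈ as → Σᴸ as δ ≈ 0#
      Σᴸ-δ []       a∉ = refl
      Σᴸ-δ (b ∷ as) a∉ = trans (+-cong (δ-other b λ b≡a → a∉ (here (≡.sym b≡a))) (Σᴸ-δ as (a∉ ∘ there)))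
                               (+-identityˡ _)

  module _ {A B : Set} {S : (A → Carrier) → Carrier} {S′ : (B → Carrier) → Carrier}
           (isS : IsSummation S) (isS′ : IsSummation S′) where
    open IsSummation

    S-swap : ∀ (f : A → B → Carrier) → S (λ a → S′ (f a)) ≈ S′ (λ b → S (λ a → f a b))
    S-swap f = trans (asList isS _) (trans (go (list isS)) (S-cong isS′ λ b → sym (asList isS _)))
      where
      go : ∀ as → Σᴸ as (λ a → S′ (f a)) ≈ S′ (λ b → Σᴸ as (λ a → f a b))
      go []       = sym (S-zero isS′ λ _ → refl)
      go (a ∷ as) = trans (+-congˡ (go as)) (sym (S-+ isS′ _ _))

  sumEdges-isSummation : ∀ {n} → IsSummation (sumEdges ℝ {n})
  sumEdges-isSummation {n} = record
    { list   = allEdges n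
    ; asList = λ f → sum-list f n λ i → sum-list f n λ j → sumIf-list f (i <? j) λ _ →
                 sym (+-identityʳ _)
    ; single = λ { (edge i j i<j) f f≈0 →
        trans (sum-single i _ λ i′ i′≢i → sum-zero n λ j′ → sumIf-zero (i′ <? j′) λ _ →
                 f≈0 _ λ e≡ → i′≢i (≡.cong Edge.i e≡))
        (trans (sum-single j _ λ j′ j′≢j → sumIf-zero (i <? j′) λ _ →
                 f≈0 _ λ e≡ → j′≢j (≡.cong Edge.j e≡))
               (sumIf-yes (i <? j) _ i<j)) }
    }

  sumTrianglesOf-isSummation : ∀ {n} (G : Graph n) → IsSummation (sumTrianglesOf ℝ G)
  sumTrianglesOf-isSummation {n} G = record
    { list   = trianglesOf G
    ; asList = λ f → sum-list f n λ i → sum-list f n λ j → sum-list f n λ k →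
        sumIf-list f (i <? j) λ i<j → sumIf-list f (j <? k) λ j<k →
        sumIf-list f (triangle i j k i<j j<k ⊆ᵗ? G) λ _ → sym (+-identityʳ _)
    ; single = λ { (triangleOf (triangle i j k i<j j<k) H⊆G) f f≈0 →
        trans (sum-single i _ λ i′ i′≢i → sum-zero n λ j′ → sum-zero n λ k′ →
                 sumIf-zero (i′ <? j′) λ p → sumIf-zero (j′ <? k′) λ q →
                 sumIf-zero (triangle i′ j′ k′ p q ⊆ᵗ? G) λ H⊆G →
                 f≈0 (triangleOf (triangle i′ j′ k′ p q) H⊆G) λ H≡ →
                 i′≢i (≡.cong (Triangle.i ∘ TriangleOf.H) H≡))
        (trans (sum-single j _ λ j′ j′≢j → sum-zero n λ k′ →
                 sumIf-zero (i <? j′) λ p → sumIf-zero (j′ <? k′) λ q →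
                 sumIf-zero (triangle i j′ k′ p q ⊆ᵗ? G) λ H⊆G →
                 f≈0 (triangleOf (triangle i j′ k′ p q) H⊆G) λ H≡ →
                 j′≢j (≡.cong (Triangle.j ∘ TriangleOf.H) H≡))
        (trans (sum-single k _ λ k′ k′≢k →
                 sumIf-zero (i <? j) λ p → sumIf-zero (j <? k′) λ q →
                 sumIf-zero (triangle i j k′ p q ⊆ᵗ? G) λ H⊆G →
                 f≈0 (triangleOf (triangle i j k′ p q) H⊆G) λ H≡ →
                 k′≢k (≡.cong (Triangle.k ∘ TriangleOf.H) H≡))
        (trans (sumIf-yes (i <? j) _ i<j) (trans (sumIf-yes (j <? k) _ j<k)
               (sumIf-yes (triangle i j k i<j j<k ⊆ᵗ? G)
                 (λ H⊆G → f (triangleOf (triangle i j k i<j j<k) H⊆G)) H⊆G))))) }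
    }

  sum-fromℕ : ∀ n → sum {n} (λ _ → 1#) ≈ fromℕ n
  sum-fromℕ zero    = refl
  sum-fromℕ (suc n) = +-congˡ (sum-fromℕ n)

  -- Pascal's rule: vertex `zero` has n edges to the other vertices, which span a complete graph on
  -- n vertices.
  sumEdges-one : ∀ n → sumEdges ℝ {n} (λ _ → 1#) ≈ fromℕ (n C 2)
  sumEdges-one zero    = refl
  sumEdges-one (suc n) =
    trans (+-cong
      (trans (+-identityˡ _) (trans
        (sum-cong n λ j → sumIf-yes (zero {n} <? suc j) (λ _ → 1#) (ℕ.s≤s ℕ.z≤n))
        (sum-fromℕ n)))
      (trans (sum-cong n λ i → trans (+-identityˡ _) (sum-cong n λ j → shift i j)) (sumEdges-one n)))
    (trans (sym (fromℕ-+ n (n C 2)))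
           (reflexive (≡.cong fromℕ (≡.trans (≡.cong (ℕ._+ n C 2) (≡.sym (nC1≡n n)))
                                             (nCk+nC[k+1]≡[n+1]C[k+1] n 1)))))
    where
    sum-cong : ∀ m {f g : Fin m → Carrier} → (∀ i → f i ≈ g i) → sum f ≈ sum g
    sum-cong m = Algebra.Properties.CommutativeMonoid.Sum.sum-cong-≋ +-commutativeMonoid

    shift : ∀ {n} (i j : Fin n) → sumIf ℝ (suc i <? suc j) (λ _ → 1#) ≈ sumIf ℝ (i <? j) (λ _ → 1#)
    shift i j with suc i <? suc j | i <? j
    ... | yes _          | yes _  = refl
    ... | yes (ℕ.s≤s lt) | no i≮j = ⊥-elim (i≮j lt)
    ... | no si≮sj       | yes lt = ⊥-elim (si≮sj (ℕ.s≤s lt))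
    ... | no _           | no _   = refl

  onTriangle : ∀ {n} → (Edge n → Carrier) → Triangle n → Carrier
  onTriangle y H = y (ij H) + y (ik H) + y (jk H)

-- Farkas' lemma

module Farkas (ℝ : Reals) {V : Set}
  (combine : Reals.Carrier ℝ → V → Reals.Carrier ℝ → V → V) where
  open Reals ℝ hiding (zero)
  open OrderedField ℝ

  record Functional : Set where
    field
      apply  : V → Carrier
      linear : ∀ a x b z → apply (combine a x b z) ≈ a * apply x + b * apply z

  open Functional public

  -- Membership in a cone containing the constraints replaces the list of multipliers in the usual
  -- conclusion of Farkas' lemma; a suitable `K` then yields a cover directly. The conditions are
  -- stated up to pointwise equality, as functions are not extensional.
  record IsConvexCone (K : (V → Carrier) → Set) : Set where
    field
      K-zero    : ∀ {χ} → (∀ x → χ x ≈ 0#) → K χ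
      K-combine : ∀ {φ ψ χ} a b → 0# ≤ a → 0# ≤ b → K φ → K ψ →
                  (∀ x → χ x ≈ a * φ x + b * ψ x) → K χ

  -- Bartl's proof of Farkas' lemma.  It needs no coordinates on V, not even
  -- the vector space laws.  If x̂ shows that α i is indispensable, subtracting
  -- multiples of α i makes every functional vanish at x̂.
  farkas : ∀ {K} → IsConvexCone K → {I : Set} (is : List I) (α : I → Functional) →
           (∀ i → i ∈ is → K (apply (α i))) → (γ : Functional) →
           (∀ x → (∀ i → i ∈ is → apply (α i) x ≤ 0#) → apply γ x ≤ 0#) →
           ¬ ¬ K (apply γ)
  -- Without constraints `γ` is nonpositive at `x` and at its negative, hence zero.
  farkas cone [] α Kα γ valid ¬Kγ = ¬Kγ (K-zero λ x →
      ≤-antisym (valid x λ _ ()) (certify (gap (≤-trans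
        (≤-reflexive (sym (linear γ (- 1#) x 0# x))) (valid (combine (- 1#) x 0# x) λ _ ())))
      (solve 1 (λ u → u ⊜ nil :+ (nil :- (:- one :* u :+ nil :* u))) refl (apply γ x))))
    where open IsConvexCone cone
  farkas {K} cone (i ∷ is) α Kα γ valid ¬Kγ = ¬¬-excluded-middle λ where
      (no none) → farkas cone is α (λ j j∈ → Kα j (there j∈)) γ
        (λ x αx≤0 → ≤-stable λ γx≰0 → none (x , αx≤0 , γx≰0)) ¬Kγ
      (yes (x̂ , αx̂≤0 , 0<γx̂)) → eliminate x̂ αx̂≤0 0<γx̂
    where
    open IsConvexCone cone

    eliminate : ∀ x̂ → (∀ j → j ∈ is → apply (α j) x̂ ≤ 0#) → 0# < apply γ x̂ → ⊥
    eliminate x̂ αx̂≤0 0<γx̂ = farkas cone is (reduce ∘ α) Kreduce (reduce γ) valid′ λ Kγ′ →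
        ¬Kγ (recover Kγ′)
      where
      p = apply (α i) x̂

      0<p : 0# < p
      0<p p≤0 = 0<γx̂ (valid x̂ λ where
        _ (here ≡.refl) → p≤0
        j (there j∈)    → αx̂≤0 j j∈)

      reduce : Functional → Functional
      reduce φ = record
        { apply  = λ x → p * apply φ x + - apply φ x̂ * apply (α i) x
        ; linear = λ a x b z → trans (+-cong (*-congˡ (linear φ a x b z)) (*-congˡ (linear (α i) a x b z)))
            (solve 8 (λ p q a b u v s t →
                p :* (a :* u :+ b :* v) :+ :- q :* (a :* s :+ b :* t) ⊜
                a :* (p :* u :+ :- q :* s) :+ b :* (p :* v :+ :- q :* t))
              refl p (apply φ x̂) a b (apply φ x) (apply φ z) (apply (α i) x) (apply (α i) z))
        }

      Kreduce : ∀ j → j ∈ is → K (apply (reduce (α j)))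
      -- The multiplier of `α i` is nonnegative because `x̂` satisfies the constraint `α j`.
      Kreduce j j∈ = K-combine p (- apply (α j) x̂) (<⇒≤ 0<p)
        (≤-trans (gap (αx̂≤0 j j∈)) (≤-reflexive (+-identityˡ _)))
        (Kα j (there j∈)) (Kα i (here ≡.refl)) λ _ → refl

      -- The adjoint of `reduce`. Its values lie in the kernel of `α i`, so constraint `i` holds
      -- there for free and the original validity of `γ` applies.
      project : V → V
      project x = combine p x (- apply (α i) x) x̂

      apply-project : ∀ φ x → apply φ (project x) ≈ apply (reduce φ) x
      apply-project φ x = trans (linear φ _ _ _ _)
        (solve 4 (λ p u v q → p :* u :+ :- v :* q ⊜ p :* u :+ :- q :* v)
          refl p (apply φ x) (apply (α i) x) (apply φ x̂))

      valid′ : ∀ x → (∀ j → j ∈ is → apply (reduce (α j)) x ≤ 0#) → apply (reduce γ) x ≤ 0#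
      valid′ x reduced≤0 = ≤-trans (≤-reflexive (sym (apply-project γ x))) (valid (project x) λ where
        _ (here ≡.refl) → ≤-reflexive (trans (linear (α i) _ _ _ _)
          (solve 2 (λ p v → p :* v :+ :- v :* p ⊜ nil) refl p (apply (α i) x)))
        j (there j∈)    → ≤-trans (≤-reflexive (apply-project (α j) x)) (reduced≤0 j j∈))

      recover : K (apply (reduce γ)) → K (apply γ)
      recover Kγ′ = K-combine (p ⁻¹) (p ⁻¹ * apply γ x̂) (⁻¹-nonneg 0<p)
        (*-nonNegative (⁻¹-nonneg 0<p) (<⇒≤ 0<γx̂)) Kγ′ (Kα i (here ≡.refl)) λ x →
        sym (trans (solve 5 (λ p q u v w → q :* (p :* u :+ :- v :* w) :+ q :* v :* w ⊜ p :* q :* u)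
                     refl p (p ⁻¹) (apply γ x) (apply γ x̂) (apply (α i) x))
                   (trans (*-congʳ (inverse 0<p)) (*-identityˡ _)))

-- Linear programming duality of packings and covers

ij≢ik : ∀ {n} (H : Triangle n) → ij H ≢ ik H
ij≢ik (triangle i j k i<j j<k) eq = ⊥-elim-irr (<-irrefl (≡.cong Edge.j eq) j<k)

ij≢jk : ∀ {n} (H : Triangle n) → ij H ≢ jk H
ij≢jk (triangle i j k i<j j<k) eq = ⊥-elim-irr (<-irrefl (≡.cong Edge.i eq) i<j)

ik≢jk : ∀ {n} (H : Triangle n) → ik H ≢ jk H
ik≢jk (triangle i j k i<j j<k) eq = ⊥-elim-irr (<-irrefl (≡.cong Edge.i eq) i<j)

module Duality (ℝ : Reals) {n} (G : Graph n) where
  open Reals ℝ hiding (zero)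
  open OrderedField ℝ
  open FiniteSums ℝ
  open IsSummation

  private
    isT = sumTrianglesOf-isSummation G
    isE = sumEdges-isSummation {n}

  load : (TriangleOf G → Carrier) → Edge n → Carrier
  load g e = sumTrianglesOf ℝ G λ H → sumIf ℝ (TriangleOf.H H ∋? e) λ _ → g H

  sumIf-cong : {P : Set} (P? : Dec P) → ∀ {x y} → x ≈ y → sumIf ℝ P? (λ _ → x) ≈ sumIf ℝ P? (λ _ → y)
  sumIf-cong (yes _) x≈y = x≈y
  sumIf-cong (no _)  x≈y = refl

  sumIf-linear : {P : Set} (P? : Dec P) → ∀ a b x y →
    sumIf ℝ P? (λ _ → a * x + b * y) ≈ a * sumIf ℝ P? (λ _ → x) + b * sumIf ℝ P? (λ _ → y)
  sumIf-linear (yes _) a b x y = refl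
  sumIf-linear (no _)  a b x y = solve 2 (λ a b → nil ⊜ a :* nil :+ b :* nil) refl a b

  sumIf-* : {P : Set} (P? : Dec P) → ∀ a x → sumIf ℝ P? (λ _ → a * x) ≈ a * sumIf ℝ P? (λ _ → x)
  sumIf-* (yes _) a x = refl
  sumIf-* (no _)  a x = sym (zeroʳ a)

  sumIf-nonneg : {P : Set} (P? : Dec P) → ∀ {x} → 0# ≤ x → 0# ≤ sumIf ℝ P? (λ _ → x)
  sumIf-nonneg (yes _) 0≤x = 0≤x
  sumIf-nonneg (no _)  0≤x = ≤-refl

  sumIf-⊎ : {P Q : Set} (P? : Dec P) (Q? : Dec Q) → (P → Q → ⊥) → ∀ x →
    sumIf ℝ (P? ⊎-dec Q?) (λ _ → x) ≈ sumIf ℝ P? (λ _ → x) + sumIf ℝ Q? (λ _ → x)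
  sumIf-⊎ (yes p) (yes q) ¬pq x = ⊥-elim (¬pq p q)
  sumIf-⊎ (yes p) (no _)  ¬pq x = sym (+-identityʳ x)
  sumIf-⊎ (no _)  (yes q) ¬pq x = sym (+-identityˡ x)
  sumIf-⊎ (no _)  (no _)  ¬pq x = sym (+-identityˡ 0#)

  at : Edge n → Edge n → Carrier → Carrier
  at e′ e x = sumIf ℝ (e ≟ᵉ e′) λ _ → x

  -- The edges of a triangle are distinct, so at most one alternative of `H ∋ e` holds.
  sumIf-∋ : ∀ H (e : Edge n) x →
    sumIf ℝ (H ∋? e) (λ _ → x) ≈ onTriangle (λ e′ → at e′ e x) H
  sumIf-∋ H e x = trans
    (sumIf-⊎ (e ≟ᵉ ij H) _ (λ { ≡.refl (inj₁ eq) → ij≢ik H eq ; ≡.refl (inj₂ eq) → ij≢jk H eq }) x)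
    (trans (+-congˡ (sumIf-⊎ (e ≟ᵉ ik H) _ (λ { ≡.refl eq → ik≢jk H eq }) x)) (sym (+-assoc _ _ _)))

  sumEdges-at : ∀ e (y : Edge n → Carrier) → sumEdges ℝ (λ e′ → at e e′ (y e′)) ≈ y e
  sumEdges-at e y = trans
    (single isE e (λ e′ → at e e′ (y e′)) λ e′ e′≢e →
      sumIf-zero (e′ ≟ᵉ e) {λ _ → y e′} λ eq → ⊥-elim-irr (e′≢e eq))
    (sumIf-yes (e ≟ᵉ e) (λ _ → y e) ≡.refl)

  onTriangle-asSum : ∀ y H → onTriangle y H ≈ sumEdges ℝ (λ e → sumIf ℝ (H ∋? e) λ _ → y e)
  onTriangle-asSum y H = sym (trans (S-cong isE λ e → sumIf-∋ H e (y e))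
    (trans (S-+ isE (λ e → y-at (ij H) e + y-at (ik H) e) (y-at (jk H)))
      (+-cong (trans (S-+ isE (y-at (ij H)) (y-at (ik H)))
        (+-cong (sumEdges-at (ij H) y) (sumEdges-at (ik H) y))) (sumEdges-at (jk H) y))))
    where
    y-at : Edge n → Edge n → Carrier
    y-at e′ e = at e′ e (y e)

  -- Packings are constrained on the edges of `G` only, whereas covers are functions on all edges of
  -- the complete graph; this bridges the two.
  load-outside : ∀ g e → ¬ T (G e) → load g e ≈ 0#
  load-outside g e e∉G = S-zero isT {λ H → sumIf ℝ (TriangleOf.H H ∋? e) λ _ → g H} λ { (triangleOf H H⊆G) →
    sumIf-zero (H ∋? e) {λ _ → g (triangleOf H H⊆G)} λ H∋e → ⊥-elim-irr (e∉G (contained H H⊆G H∋e)) }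
    where
    contained : ∀ H → H ⊆ᵗ G → H ∋ e → T (G e)
    contained H (p , q , r) (inj₁ ≡.refl)        = p
    contained H (p , q , r) (inj₂ (inj₁ ≡.refl)) = q
    contained H (p , q , r) (inj₂ (inj₂ ≡.refl)) = r

  -- Double counting: the sum of `g H * y e` over incident pairs is at least `q` times the value of
  -- `g`, and at most the total of `y` since every load is at most 1. The factor `q` admits covers
  -- that have not been normalised.
  weakDuality : ∀ {g y q} → IsFractionalPacking ℝ G g → (∀ e → 0# ≤ y e) →
                (∀ H → q ≤ onTriangle y (TriangleOf.H H)) →
                q * sumTrianglesOf ℝ G g ≤ sumEdges ℝ y
  weakDuality {g} {y} {q} packing 0≤y covers =
    ≤-trans (≤-reflexive (sym (S-* isT q g)))
    (≤-trans (S-mono isT λ H → ≤-trans (≤-reflexive (*-comm q (g H)))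
      (≤-trans (*-monoˡ-≤ (nonNegative H) (covers H))
        (≤-reflexive (trans (*-congˡ (onTriangle-asSum y (TriangleOf.H H)))
          (sym (S-* isE (g H) λ e → sumIf ℝ (TriangleOf.H H ∋? e) λ _ → y e))))))
    (≤-trans (≤-reflexive (S-swap isT isE λ H e → g H * sumIf ℝ (TriangleOf.H H ∋? e) λ _ → y e))
    (S-mono isE λ e → ≤-trans (≤-reflexive (trans
        (S-cong isT λ H → trans (sym (sumIf-* (TriangleOf.H H ∋? e) (g H) (y e)))
          (trans (sumIf-cong (TriangleOf.H H ∋? e) (*-comm (g H) (y e)))
            (sumIf-* (TriangleOf.H H ∋? e) (y e) (g H))))
        (S-* isT (y e) λ H → sumIf ℝ (TriangleOf.H H ∋? e) λ _ → g H)))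
      (≤-trans (*-monoˡ-≤ (0≤y e) (load≤1 e)) (≤-reflexive (*-identityʳ (y e)))))))
    where
    open IsFractionalPacking packing

    load≤1 : ∀ e → load g e ≤ 1#
    load≤1 e with T? (G e)
    ... | yes e∈G = capacity e e∈G
    ... | no e∉G  = ≤-trans (≤-reflexive (load-outside g e e∉G)) 0≤1

  load-linear : ∀ a b g g′ e → load (λ H → a * g H + b * g′ H) e ≈ a * load g e + b * load g′ e
  load-linear a b g g′ e = trans (S-cong isT λ H → sumIf-linear (TriangleOf.H H ∋? e) a b (g H) (g′ H))
    (S-linear isT a b (λ H → sumIf ℝ (TriangleOf.H H ∋? e) λ _ → g H)
                      (λ H → sumIf ℝ (TriangleOf.H H ∋? e) λ _ → g′ H))

  load-zero : ∀ e → load (λ _ → 0#) e ≈ 0#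
  load-zero e = S-zero isT {λ H → sumIf ℝ (TriangleOf.H H ∋? e) λ _ → 0#} λ H →
    sumIf-zero (TriangleOf.H H ∋? e) λ _ → refl

  value : (TriangleOf G → Carrier) → Carrier
  value = sumTrianglesOf ℝ G

  Packing : (TriangleOf G → Carrier) → Set
  Packing = IsFractionalPacking ℝ G

  IsCover : (Edge n → Carrier) → Set
  IsCover y = (∀ e → 0# ≤ y e) × (∀ (H : TriangleOf G) → 1# ≤ onTriangle y (TriangleOf.H H))

  Point : Set
  Point = (TriangleOf G → Carrier) × Carrier

  combine : Carrier → Point → Carrier → Point → Point
  combine a (g , h) b (g′ , h′) = (λ H → a * g H + b * g′ H) , a * h + b * h′

  open Farkas ℝ combine

  data Constraint : Set where
    objective   : Constraint
    nonnegative : TriangleOf G → Constraint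
    capacity    : Edge n → Constraint

  constraints : List Constraint
  constraints = objective ∷ map nonnegative (list isT) ++ map capacity (list isE)

  -- Packings of total value at least t, homogenised by an extra coordinate h.
  functional : Carrier → Constraint → Functional
  functional t objective = record
    { apply  = λ (g , h) → t * h - value g
    ; linear = λ a (g , h) b (g′ , h′) → trans (+-congˡ (-‿cong (S-linear isT a b g g′)))
        (solve 7 (λ t a b h h′ u v →
            t :* (a :* h :+ b :* h′) :- (a :* u :+ b :* v) ⊜ a :* (t :* h :- u) :+ b :* (t :* h′ :- v))
          refl t a b h h′ (value g) (value g′))
    }
  functional t (nonnegative H) = record
    { apply  = λ (g , h) → - g H
    ; linear = λ a (g , h) b (g′ , h′) →
        solve 4 (λ a b u v → :- (a :* u :+ b :* v) ⊜ a :* :- u :+ b :* :- v) refl a b (g H) (g′ H)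
    }
  functional t (capacity e) = record
    { apply  = λ (g , h) → load g e - h
    ; linear = λ a (g , h) b (g′ , h′) → trans (+-congʳ (load-linear a b g g′ e))
        (solve 6 (λ a b h h′ u v →
            a :* u :+ b :* v :- (a :* h :+ b :* h′) ⊜ a :* (u :- h) :+ b :* (v :- h′))
          refl a b h h′ (load g e) (load g′ e))
    }

  height : Functional
  height = record { apply = proj₂ ; linear = λ _ _ _ _ → refl }

  δ : TriangleOf G → TriangleOf G → Carrier
  δ H H′ = sumIf ℝ (H′ ≟ᵍ H) λ _ → 1#

  δ-self : ∀ H → δ H H ≈ 1#
  δ-self H = sumIf-yes (H ≟ᵍ H) (λ _ → 1#) ≡.refl

  δ-other : ∀ {H H′} → H′ ≢ H → δ H H′ ≈ 0#
  δ-other {H} {H′} H′≢H = sumIf-zero (H′ ≟ᵍ H) {λ _ → 1#} λ eq → ⊥-elim-irr (H′≢H eq)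

  value-δ : ∀ H → value (δ H) ≈ 1#
  value-δ H = trans (single isT H (δ H) λ H′ → δ-other) (δ-self H)

  load-δ : ∀ H e → load (δ H) e ≈ onTriangle (λ e′ → at e′ e 1#) (TriangleOf.H H)
  load-δ H e = trans
    (single isT H (λ H′ → sumIf ℝ (TriangleOf.H H′ ∋? e) λ _ → δ H H′) λ H′ H′≢H →
      sumIf-zero (TriangleOf.H H′ ∋? e) {λ _ → δ H H′} λ _ → δ-other H′≢H)
    (trans (sumIf-cong (TriangleOf.H H ∋? e) (δ-self H)) (sumIf-∋ (TriangleOf.H H) e 1#))

  -- The functionals bounded above, on the nonnegative orthant, by a
  -- combination of the constraints with multipliers y e and s.
  Dual : Carrier → (Point → Carrier) → Set
  Dual t φ = ∃[ y ] ∃[ s ] ((∀ e → 0# ≤ y e) × 0# ≤ s ×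
    (∀ H → φ (δ H , 0#) ≤ onTriangle y (TriangleOf.H H) - s) ×
    φ ((λ _ → 0#) , 1#) ≤ s * t - sumEdges ℝ y)

  sumEdges-zero : sumEdges ℝ {n} (λ _ → 0#) ≈ 0#
  sumEdges-zero = S-zero isE λ _ → refl

  Dual-isConvexCone : ∀ t → IsConvexCone (Dual t)
  Dual-isConvexCone t = record
    { K-zero    = λ χ≈0 → (λ _ → 0#) , 0# , (λ _ → ≤-refl) , ≤-refl ,
        (λ H → ≤-reflexive (trans (χ≈0 _) (solve 0 (nil ⊜ nil :+ nil :+ nil :- nil) refl))) ,
        ≤-reflexive (trans (χ≈0 _) (trans (solve 1 (λ t → nil ⊜ nil :* t :- nil) refl t)
          (+-congˡ (-‿cong (sym sumEdges-zero)))))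
    ; K-combine = λ { a b 0≤a 0≤b (y , s , 0≤y , 0≤s , onδ , onh) (y′ , s′ , 0≤y′ , 0≤s′ , onδ′ , onh′) χ≈ →
        (λ e → a * y e + b * y′ e) , a * s + b * s′ ,
        (λ e → +-nonneg (*-nonNegative 0≤a (0≤y e)) (*-nonNegative 0≤b (0≤y′ e))) ,
        +-nonneg (*-nonNegative 0≤a 0≤s) (*-nonNegative 0≤b 0≤s′) ,
        (λ { (triangleOf H H⊆G) → ≤-trans (≤-reflexive (χ≈ _))
          (≤-trans (+-mono-≤ (*-monoˡ-≤ 0≤a (onδ (triangleOf H H⊆G)))
                            (*-monoˡ-≤ 0≤b (onδ′ (triangleOf H H⊆G))))
          (≤-reflexive (solve 10 (λ a b s s′ p q r p′ q′ r′ →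
              a :* (p :+ q :+ r :- s) :+ b :* (p′ :+ q′ :+ r′ :- s′) ⊜
              a :* p :+ b :* p′ :+ (a :* q :+ b :* q′) :+ (a :* r :+ b :* r′) :- (a :* s :+ b :* s′))
            refl a b s s′ (y (ij H)) (y (ik H)) (y (jk H)) (y′ (ij H)) (y′ (ik H)) (y′ (jk H))))) }) ,
        ≤-trans (≤-reflexive (χ≈ _)) (≤-trans (+-mono-≤ (*-monoˡ-≤ 0≤a onh) (*-monoˡ-≤ 0≤b onh′))
          (≤-reflexive (trans (solve 7 (λ a b s s′ t u v →
              a :* (s :* t :- u) :+ b :* (s′ :* t :- v) ⊜
              (a :* s :+ b :* s′) :* t :- (a :* u :+ b :* v))
            refl a b s s′ t (sumEdges ℝ y) (sumEdges ℝ y′))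
            (+-congˡ (-‿cong (sym (S-linear isE a b y y′))))))) }
    }

  -- The multiplier is 1 at the constraint itself and 0 elsewhere; `nonnegative H` needs none,
  -- because its functional is nonpositive on the orthant.
  functional∈Dual : ∀ t c → Dual t (apply (functional t c))
  functional∈Dual t objective = (λ _ → 0#) , 1# , (λ _ → ≤-refl) , 0≤1 ,
    (λ H → ≤-reflexive (trans (+-congˡ (-‿cong (value-δ H)))
      (solve 1 (λ t → t :* nil :- one ⊜ nil :+ nil :+ nil :- one) refl t))) ,
    ≤-reflexive (+-cong (*-comm t 1#) (-‿cong (trans (S-zero isT λ _ → refl) (sym sumEdges-zero))))
  functional∈Dual t (nonnegative H) = (λ _ → 0#) , 0# , (λ _ → ≤-refl) , ≤-refl ,
    (λ H′ → certify (sumIf-nonneg (H ≟ᵍ H′) 0≤1)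
      (solve 1 (λ u → nil :+ nil :+ nil :- nil ⊜ :- u :+ u) refl (δ H′ H))) ,
    ≤-reflexive (trans (solve 1 (λ t → :- nil ⊜ nil :* t :- nil) refl t)
      (+-congˡ (-‿cong (sym sumEdges-zero))))
  functional∈Dual t (capacity e) = (λ e′ → at e′ e 1#) , 0# , (λ e′ → sumIf-nonneg (e ≟ᵉ e′) 0≤1) , ≤-refl ,
    (λ H → ≤-reflexive (+-congʳ (load-δ H e))) ,
    ≤-reflexive (trans (+-congʳ (load-zero e)) (trans (solve 1 (λ t → nil :- one ⊜ nil :* t :- one) refl t)
      (+-congˡ (-‿cong (sym (trans (single isE e (λ e′ → at e′ e 1#) λ e′ e′≢e →
          sumIf-zero (e ≟ᵉ e′) {λ _ → 1#} λ eq → ⊥-elim-irr (e′≢e (≡.sym eq)))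
        (sumIf-yes (e ≟ᵉ e) (λ _ → 1#) ≡.refl)))))))

  -- A feasible point with positive height could be rescaled to height 1, a packing of value at
  -- least `t`. So the constraints force `height` to be nonpositive, and Farkas' lemma yields
  -- multipliers with `s` at most `y` on each triangle and `1 + Σ y ≤ s t`. The latter makes `s`
  -- positive, and `y / s` is the required cover.
  strongDuality : ∀ t → ¬ (∃[ g ] Packing g × t ≤ value g) →
                  ¬ ¬ (∃[ y ] IsCover y × sumEdges ℝ y < t)
  strongDuality t noPacking noCover =
    farkas (Dual-isConvexCone t) constraints (functional t) (λ c _ → functional∈Dual t c) height valid
      λ (y , s , 0≤y , 0≤s , onδ , onh) →
        let 0≤Σy = S-nonneg isE 0≤y
            0<s : 0# < s
            0<s s≤0 = 0<1 (≤-trans onh (≤-trans (certify 0≤Σy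
              (solve 2 (λ a b → a ⊜ a :- b :+ b) refl (s * t) (sumEdges ℝ y)))
              (≤-reflexive (trans (*-congʳ (≤-antisym s≤0 0≤s)) (zeroˡ t)))))
        in noCover ((λ e → s ⁻¹ * y e) ,
          ((λ e → *-nonNegative (⁻¹-nonneg 0<s) (0≤y e)) ,
           λ H → *-cancelˡ-≤ 0<s (certify (onδ H)
             (trans (trans (distribute s (s ⁻¹)
                 (y (ij (TriangleOf.H H))) (y (ik (TriangleOf.H H))) (y (jk (TriangleOf.H H))))
               (trans (*-congʳ (inverse 0<s)) (*-identityˡ _)))
               (solve 2 (λ u s → u ⊜ s :* one :+ (u :- s)) refl (onTriangle y (TriangleOf.H H)) s)))) ,
          λ t≤ → 0<1 (≤-trans onh (gap⁻¹ (≤-trans (gap (*-monoˡ-≤ 0≤s t≤))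
            (≤-reflexive (trans (+-congʳ (trans (*-congˡ (S-* isE (s ⁻¹) y))
              (trans (sym (*-assoc _ _ _)) (trans (*-congʳ (inverse 0<s)) (*-identityˡ _)))))
              (solve 2 (λ u v → u :- v ⊜ nil :- (v :- u)) refl (sumEdges ℝ y) (s * t))))))))
    where
    distribute : ∀ s s⁻¹ p q r → s * (s⁻¹ * p + s⁻¹ * q + s⁻¹ * r) ≈ s * s⁻¹ * (p + q + r)
    distribute = solve 5 (λ s s⁻¹ p q r →
      s :* (s⁻¹ :* p :+ s⁻¹ :* q :+ s⁻¹ :* r) ⊜ s :* s⁻¹ :* (p :+ q :+ r)) refl

    valid : ∀ x → (∀ c → c ∈ constraints → apply (functional t c) x ≤ 0#) → proj₂ x ≤ 0#
    valid (g , h) feasible = ≤-stable λ 0<h → noPacking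
      ((λ H → h ⁻¹ * g H) ,
       record
         { nonNegative = λ H → *-nonNegative (⁻¹-nonneg 0<h) (≤-trans
             (gap (feasible (nonnegative H) (there (∈-++⁺ˡ (∈-map⁺ nonnegative (∈-list isT _≟ᵍ_ H))))))
             (≤-reflexive (solve 1 (λ u → nil :- :- u ⊜ u) refl (g H))))
         ; capacity    = λ e _ → *-cancelˡ-≤ 0<h (≤-trans (≤-reflexive (h*load e 0<h))
             (gap⁻¹ (≤-trans
               (gap (feasible (capacity e) (there (∈-++⁺ʳ _ (∈-map⁺ capacity (∈-list isE _≟ᵉ_ e))))))
               (≤-reflexive (solve 2 (λ l h → nil :- (l :- h) ⊜ h :* one :- l) refl (load g e) h)))))
         } ,
       *-cancelˡ-≤ 0<h (gap⁻¹ (≤-trans (gap (feasible objective (here ≡.refl)))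
         (≤-reflexive (trans (solve 3 (λ t h u → nil :- (t :* h :- u) ⊜ u :- h :* t) refl t h (value g))
           (+-congʳ (sym (trans (*-congˡ (S-* isT (h ⁻¹) g)) (h*h⁻¹* (value g) 0<h)))))))))
      where
      h*h⁻¹* : ∀ u → 0# < h → h * (h ⁻¹ * u) ≈ u
      h*h⁻¹* u 0<h = trans (sym (*-assoc _ _ _)) (trans (*-congʳ (inverse 0<h)) (*-identityˡ _))

      h*load : ∀ e → 0# < h → h * load (λ H → h ⁻¹ * g H) e ≈ load g e
      h*load e 0<h = trans (*-congˡ (trans (S-cong isT λ H → sumIf-* (TriangleOf.H H ∋? e) (h ⁻¹) (g H))
        (S-* isT (h ⁻¹) λ H → sumIf ℝ (TriangleOf.H H ∋? e) λ _ → g H))) (h*h⁻¹* _ 0<h)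

  valueBound : ∀ {g y} → Packing g → IsCover y → value g ≤ sumEdges ℝ y
  valueBound packing (0≤y , covers) =
    ≤-trans (≤-reflexive (sym (*-identityˡ _))) (weakDuality packing 0≤y covers)

  -- If the supremum of the values were not attained, strong duality would give a cover of smaller
  -- total, hence a smaller upper bound.
  maximumExists : ¬ ¬ (∃[ t ] Is-τ* ℝ G t)
  maximumExists noMaximum = strongDuality s
      (λ (g , packing , s≤) →
        noMaximum (s , (g , packing , ≤-antisym s≤ (upper _ (g , packing , refl))) , upper))
      λ (y , cover , Σy<s) → Σy<s (least _ λ { t (g , packing , t≈) →
        ≤-trans (≤-reflexive t≈) (valueBound packing cover) })
    where
    Attained : Carrier → Set
    Attained t = ∃[ g ] (Packing g × t ≈ value g)

    zeroPacking : Packing (λ _ → 0#)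
    zeroPacking = record
      { nonNegative = λ _ → ≤-refl
      ; capacity    = λ e _ → ≤-trans (≤-reflexive (load-zero e)) 0≤1
      }

    oneCover : IsCover (λ _ → 1#)
    oneCover = (λ _ → 0≤1) , λ _ → certify 0≤2 (+-assoc _ _ _)

    lub = supremum Attained (_ , _ , zeroPacking , refl)
      (_ , λ { t (g , packing , t≈) → ≤-trans (≤-reflexive t≈) (valueBound packing oneCover) })
    s = proj₁ lub
    upper = proj₁ (proj₂ lub)
    least = proj₂ (proj₂ lub)

  -- Strong duality gives covers only below values that no packing reaches, such as `t + 1#`.
  nearOptimalCover : ∀ {t} → Is-τ* ℝ G t → ¬ ¬ (∃[ y ] IsCover y × sumEdges ℝ y ≤ t + 1#)
  nearOptimalCover {t} (_ , upper) noCover = strongDuality (t + 1#)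
    (λ (g , packing , t+1≤) → 0<1 (gap⁻¹ (≤-trans (gap (≤-trans t+1≤ (upper _ (g , packing , refl))))
      (≤-reflexive (solve 1 (λ t → t :- (t :+ one) ⊜ nil :- one) refl t)))))
    λ (y , cover , Σy<) → noCover (y , cover , <⇒≤ Σy<)

-- Colour classes and their weights

hasColour-self : ∀ x → T (hasColour x x)
hasColour-self red  = _
hasColour-self blue = _

hasColour⇒≡ : ∀ x y → T (hasColour x y) → x ≡ y
hasColour⇒≡ red  red  _ = ≡.refl
hasColour⇒≡ blue blue _ = ≡.refl

someTriangle : ∀ {n} → 3 ℕ.≤ n → Triangle n
someTriangle (ℕ.s≤s (ℕ.s≤s (ℕ.s≤s _))) =
  triangle zero (suc zero) (suc (suc zero)) (ℕ.s≤s ℕ.z≤n) (ℕ.s≤s (ℕ.s≤s ℕ.z≤n))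

containingTriangle : ∀ {n} → 3 ℕ.≤ n → (e : Edge n) → ∃[ H ] H ∋ e
containingTriangle (ℕ.s≤s (ℕ.s≤s (ℕ.s≤s _))) (edge zero (suc zero) i<j) =
  triangle zero (suc zero) (suc (suc zero)) i<j (ℕ.s≤s (ℕ.s≤s ℕ.z≤n)) , inj₁ ≡.refl
containingTriangle (ℕ.s≤s (ℕ.s≤s (ℕ.s≤s _))) (edge zero (suc (suc j)) i<j) =
  triangle zero (suc zero) (suc (suc j)) (ℕ.s≤s ℕ.z≤n) (ℕ.s≤s (ℕ.s≤s ℕ.z≤n)) , inj₂ (inj₁ ≡.refl)
containingTriangle (ℕ.s≤s (ℕ.s≤s (ℕ.s≤s _))) (edge (suc i) j i<j) =
  triangle zero (suc i) j (ℕ.s≤s ℕ.z≤n) i<j , inj₂ (inj₂ ≡.refl)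

module RamseyBounds (ℝ : Reals) where
  open Reals ℝ hiding (zero)
  open OrderedField ℝ
  open FiniteSums ℝ
  open IsSummation

  private
    isE : ∀ {n} → IsSummation (sumEdges ℝ {n})
    isE = sumEdges-isSummation

  sum-atMostOne : ∀ {n} {f : Fin n → Carrier} {a} → 0# ≤ a → (∀ j → f j ≤ a) →
                  (∀ j k → j Fin.< k → f j ≈ 0# ⊎ f k ≈ 0#) → sum f ≤ a
  sum-atMostOne {zero}  0≤a f≤a alone = 0≤a
  sum-atMostOne {suc n} {f} 0≤a f≤a alone with f zero ≟ 0#
  ... | yes f0≈0 = ≤-trans (≤-reflexive (trans (+-congʳ f0≈0) (+-identityˡ _)))
    (sum-atMostOne 0≤a (f≤a ∘ suc) λ j k j<k → alone (suc j) (suc k) (ℕ.s≤s j<k))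
  ... | no f0≉0  = ≤-trans (≤-reflexive (trans (+-congˡ (sum-zero n λ j → tail≈0 j)) (+-identityʳ _)))
    (f≤a zero)
    where
    tail≈0 : ∀ j → f (suc j) ≈ 0#
    tail≈0 j with alone zero (suc j) (ℕ.s≤s ℕ.z≤n)
    ... | inj₁ f0≈0 = ⊥-elim (f0≉0 f0≈0)
    ... | inj₂ fj≈0 = fj≈0

  sum-bounded : ∀ n {f : Fin n → Carrier} {a} → (∀ i → f i ≤ a) → sum f ≤ fromℕ n * a
  sum-bounded zero    {a = a} f≤a = ≤-reflexive (sym (zeroˡ a))
  sum-bounded (suc n) {a = a} f≤a = ≤-trans (+-mono-≤ (f≤a zero) (sum-bounded n (f≤a ∘ suc)))
    (≤-reflexive (solve 2 (λ a m → a :+ m :* a ⊜ (one :+ m) :* a) refl a (fromℕ n)))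

  sum-+ : ∀ n {f g h : Fin n → Carrier} → (∀ i → h i ≈ f i + g i) → sum h ≈ sum f + sum g
  sum-+ zero    h≈ = sym (+-identityˡ 0#)
  sum-+ (suc n) h≈ = trans (+-cong (h≈ zero) (sum-+ n (h≈ ∘ suc)))
    (solve 4 (λ a b c d → a :+ b :+ (c :+ d) ⊜ a :+ c :+ (b :+ d)) refl _ _ _ _)

  module _ {n} (c : Colouring n) where

    -- Chosen so that `colourWeight ℝ w c H x` unfolds to `onTriangle (restrict x w) H`.
    restrict : Colour → (Edge n → Carrier) → Edge n → Carrier
    restrict x f e = if colourClass c x e then f e else 0#

    restrict-in : ∀ {x} f {e} → T (colourClass c x e) → restrict x f e ≈ f e
    restrict-in {x} f {e} e∈ with colourClass c x e
    ... | true = refl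

    restrict-out : ∀ {x} f {e} → ¬ T (colourClass c x e) → restrict x f e ≈ 0#
    restrict-out {x} f {e} e∉ with colourClass c x e
    ... | true  = ⊥-elim (e∉ _)
    ... | false = refl

    restrict-nonneg : ∀ x {f} → (∀ e → 0# ≤ f e) → ∀ e → 0# ≤ restrict x f e
    restrict-nonneg x {f} 0≤f e with colourClass c x e
    ... | true  = 0≤f e
    ... | false = ≤-refl

    restrict-≤ : ∀ x {f e a} → 0# ≤ a → f e ≤ a → restrict x f e ≤ a
    restrict-≤ x {e = e} 0≤a f≤a with colourClass c x e
    ... | true  = f≤a
    ... | false = 0≤a

    restrict-* : ∀ x a f e → restrict x (λ e → a * f e) e ≈ a * restrict x f e
    restrict-* x a f e with colourClass c x e
    ... | true  = refl
    ... | false = sym (zeroʳ a)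

    restrict-split : ∀ f e → f e ≈ restrict red f e + restrict blue f e
    restrict-split f e with c e
    ... | red  = sym (+-identityʳ _)
    ... | blue = sym (+-identityˡ _)

    inOwnClass : ∀ e → T (colourClass c (c e) e)
    inOwnClass e = hasColour-self (c e)

  onTriangle-nonneg : ∀ {n} {y : Edge n → Carrier} → (∀ e → 0# ≤ y e) → ∀ H → 0# ≤ onTriangle y H
  onTriangle-nonneg 0≤y H = +-nonneg (+-nonneg (0≤y _) (0≤y _)) (0≤y _)

  ≤onTriangle : ∀ {n} {y : Edge n → Carrier} → (∀ e → 0# ≤ y e) → ∀ {H e} → H ∋ e → y e ≤ onTriangle y H
  ≤onTriangle {y = y} 0≤y {H} (inj₁ ≡.refl)        = certify (+-nonneg (0≤y _) (0≤y _)) (+-assoc _ _ _)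
  ≤onTriangle {y = y} 0≤y {H} (inj₂ (inj₁ ≡.refl)) = certify (+-nonneg (0≤y (ij H)) (0≤y (jk H)))
    (solve 3 (λ p q r → p :+ q :+ r ⊜ q :+ (p :+ r)) refl (y (ij H)) (y (ik H)) (y (jk H)))
  ≤onTriangle {y = y} 0≤y {H} (inj₂ (inj₂ ≡.refl)) = certify (+-nonneg (0≤y (ij H)) (0≤y (ik H)))
    (+-comm _ _)

  -- From weightings to covers

  module LowerBound {n} (3≤n : 3 ℕ.≤ n) {w : Edge n → Carrier} {c : Colouring n} {a}
                    (weighting : IsWeighting ℝ w)
                    (bounded : ∀ H x → colourWeight ℝ w c H x ≤ a) where
    open IsWeighting weighting

    0≤part : ∀ x e → 0# ≤ restrict c x w e
    0≤part x = restrict-nonneg c x nonNegative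

    w≤a : ∀ e → w e ≤ a
    w≤a e = let H , H∋e = containingTriangle 3≤n e in
      ≤-trans (≤-reflexive (sym (restrict-in c w (inOwnClass c e))))
        (≤-trans (≤onTriangle (0≤part (c e)) H∋e) (bounded H (c e)))

    0≤a : 0# ≤ a
    0≤a = ≤-trans (onTriangle-nonneg (0≤part red) (someTriangle 3≤n)) (bounded _ red)

    -- `slack` is the cover `max(0, 1 - 2w / a)` scaled by `a`, which avoids dividing by `a`;
    -- `excess` is what taking the positive part adds to `a - 2w`.
    excess slack : Edge n → Carrier
    excess e = posPart (w e + w e - a)
    slack e  = posPart (a - (w e + w e))

    excess≤a : ∀ e → excess e ≤ a
    excess≤a e = posPart-lub 0≤a (certify (+-nonneg (gap (w≤a e)) (gap (w≤a e)))
      (solve 2 (λ a w → a ⊜ w :+ w :- a :+ (a :- w :+ (a :- w))) refl a (w e)))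

    -- Two edges of the same colour in a triangle cannot both weigh more than a / 2.
    excess-alone : ∀ H x → restrict c x excess (ij H) ≈ 0# ⊎ restrict c x excess (ik H) ≈ 0#
    excess-alone H x with T? (colourClass c x (ij H)) | T? (colourClass c x (ik H))
    ... | no ij∉  | _       = inj₁ (restrict-out c excess ij∉)
    ... | yes _   | no ik∉  = inj₂ (restrict-out c excess ik∉)
    ... | yes ij∈ | yes ik∈ = light (w (ij H) + w (ij H) - a ≤? 0#)
      where
      w+w≤a : w (ij H) + w (ik H) ≤ a
      w+w≤a = ≤-trans (≤-reflexive (sym (+-cong (restrict-in c w ij∈) (restrict-in c w ik∈))))
        (≤-trans (certify (0≤part x (jk H)) refl) (bounded H x))

      light : Dec (w (ij H) + w (ij H) - a ≤ 0#) →
              restrict c x excess (ij H) ≈ 0# ⊎ restrict c x excess (ik H) ≈ 0#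
      light (yes ij≤0) = inj₁ (trans (restrict-in c excess ij∈) (posPart-zero ij≤0))
      light (no ij≰0)  = inj₂ (trans (restrict-in c excess ik∈) (posPart-zero
        (certify (+-nonneg (<⇒≤ ij≰0) (+-nonneg (gap w+w≤a) (gap w+w≤a)))
          (solve 3 (λ u v a → nil ⊜ v :+ v :- a :+ (u :+ u :- a :+ (a :- (u :+ v) :+ (a :- (u :+ v)))))
            refl (w (ij H)) (w (ik H)) a))))

    -- Row `i` holds the edges whose smaller endpoint is `i`. Two of them are the edges `ij` and
    -- `ik` of a triangle, the only pair that `excess-alone` has to treat.
    excessRow : Colour → Fin n → Fin n → Carrier
    excessRow x i j = sumIf ℝ (i <? j) λ i<j → restrict c x excess (edge i j i<j)

    excessRow-bound : ∀ x i → sum (excessRow x i) ≤ a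
    excessRow-bound x i = sum-atMostOne 0≤a row≤a alone
      where
      row≤a : ∀ j → excessRow x i j ≤ a
      row≤a j with i <? j
      ... | yes i<j = restrict-≤ c x {excess} 0≤a (excess≤a (edge i j i<j))
      ... | no _    = 0≤a

      alone : ∀ j k → j Fin.< k → excessRow x i j ≈ 0# ⊎ excessRow x i k ≈ 0#
      alone j k j<k with i <? j | i <? k
      ... | no _    | _     = inj₁ refl
      ... | yes _   | no _  = inj₂ refl
      ... | yes i<j | yes _ = excess-alone (triangle i j k i<j j<k) x

    excess-total : sumEdges ℝ excess ≤ fromℕ n * (a + a)
    excess-total = sum-bounded n λ i → ≤-trans (≤-reflexive (sum-+ n (split i)))
      (+-mono-≤ (excessRow-bound red i) (excessRow-bound blue i))
      where
      split : ∀ i j → sumIf ℝ (i <? j) (λ i<j → excess (edge i j i<j)) ≈ excessRow red i j + excessRow blue i j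
      split i j with i <? j
      ... | yes i<j = restrict-split c excess (edge i j i<j)
      ... | no _    = sym (+-identityˡ 0#)

    0≤slack : ∀ e → 0# ≤ slack e
    0≤slack e = 0≤posPart _

    -- The three terms `a - 2w` sum to at least `3a - 2a`, and positive parts only enlarge them.
    slack-covers : ∀ x (H : TriangleOf (colourClass c x)) → a ≤ onTriangle (restrict c x slack) (TriangleOf.H H)
    -- The containment is an irrelevant field; decidability makes it available for case analysis.
    slack-covers x (triangleOf H H⊆G) = covers (recompute (H ⊆ᵗ? colourClass c x) H⊆G)
      where
      covers : H ⊆ᵗ colourClass c x → a ≤ onTriangle (restrict c x slack) H
      covers (ij∈ , ik∈ , jk∈) = ≤-trans
        (certify (+-nonneg (gap weight≤a) (gap weight≤a))
          (solve 4 (λ a p q r → a :- (p :+ p) :+ (a :- (q :+ q)) :+ (a :- (r :+ r)) ⊜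
                                a :+ (a :- (p :+ q :+ r) :+ (a :- (p :+ q :+ r))))
            refl a (w (ij H)) (w (ik H)) (w (jk H))))
        (+-mono-≤ (+-mono-≤ (lower ij∈) (lower ik∈)) (lower jk∈))
        where
        lower : ∀ {e} → T (colourClass c x e) → a - (w e + w e) ≤ restrict c x slack e
        lower e∈ = ≤-trans (x≤posPart _) (≤-reflexive (sym (restrict-in c slack e∈)))

        weight≤a : w (ij H) + w (ik H) + w (jk H) ≤ a
        weight≤a = ≤-trans (≤-reflexive (sym (+-cong (+-cong
          (restrict-in c w ij∈) (restrict-in c w ik∈)) (restrict-in c w jk∈)))) (bounded H x)

    packing-bound : ∀ x {t} → Is-τ* ℝ (colourClass c x) t → a * t ≤ sumEdges ℝ (restrict c x slack)
    packing-bound x ((g , packing , t≈) , _) = ≤-trans (≤-reflexive (*-congˡ t≈))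
      (weakDuality packing (restrict-nonneg c x 0≤slack) (slack-covers x))
      where open Duality ℝ (colourClass c x)

    slack-total : sumEdges ℝ slack ≤ a * fromℕ (n C 2) - (1# + 1#) * fromℕ (n C 2) + fromℕ n * (a + a)
    slack-total = ≤-trans (S-mono isE slack≤) (≤-trans
      (≤-reflexive (trans (S-+ isE (λ e → a * 1# + - (1# + 1#) * w e) excess) (+-congʳ
        (trans (S-linear isE a (- (1# + 1#)) (λ _ → 1#) w)
        (trans (+-cong (*-congˡ (sumEdges-one n)) (*-congˡ total′))
          (solve 2 (λ a C → a :* C :+ :- two :* C ⊜ a :* C :- two :* C) refl a (fromℕ (n C 2))))))))
      (+-mono-≤ ≤-refl excess-total))
      where
      total′ = IsWeighting.total weighting
      slack≤ : ∀ e → slack e ≤ a * 1# + - (1# + 1#) * w e + excess e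
      slack≤ e = posPart-lub
        (certify (gap (x≤posPart (w e + w e - a)))
          (solve 3 (λ a w z → a :* one :+ :- two :* w :+ z ⊜ nil :+ (z :- (w :+ w :- a)))
            refl a (w e) (excess e)))
        (certify (0≤posPart (w e + w e - a))
          (solve 3 (λ a w z → a :* one :+ :- two :* w :+ z ⊜ a :- (w :+ w) :+ z) refl a (w e) (excess e)))

    -- By weak duality `a * t` is at most the total slack. Comparing `t` with the colouring `c`
    -- requires its packing maxima, which exist up to double negation; that suffices for an
    -- inequality.
    lowerBound : ∀ {t} → Is-τ*ₙ ℝ n t →
      (1# + 1#) * fromℕ (n C 2) + a * t ≤ a * fromℕ (n C 2) + fromℕ n * (a + a)
    lowerBound {t} (_ , least) = ≤-stable λ fails →
      maximumExists red λ (r , isR) → maximumExists blue λ (b , isB) →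
      let t≤r+b = least (r + b) (c , r , b , isR , isB , refl)
          a*t≤ : a * t ≤ sumEdges ℝ slack
          a*t≤ = ≤-trans (*-monoˡ-≤ 0≤a t≤r+b) (≤-trans (≤-reflexive (distribˡ a r b))
            (≤-trans (+-mono-≤ (packing-bound red isR) (packing-bound blue isB))
              (≤-reflexive (sym (trans (S-cong (isE {n}) (restrict-split c slack))
                (S-+ (isE {n}) (restrict c red slack) (restrict c blue slack)))))))
      in fails (certify (gap (≤-trans a*t≤ slack-total))
        (solve 4 (λ a t C N → a :* C :+ N :* (a :+ a) ⊜ two :* C :+ a :* t :+
            (a :* C :- two :* C :+ N :* (a :+ a) :- a :* t))
          refl a t (fromℕ (n C 2)) (fromℕ n)))
      where
      maximumExists : ∀ x → ¬ ¬ (∃[ t ] Is-τ* ℝ (colourClass c x) t)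
      maximumExists x = Duality.maximumExists ℝ (colourClass c x)

  wR-nonneg : ∀ {n a} → 3 ℕ.≤ n → Is-wR ℝ n a → 0# ≤ a
  wR-nonneg 3≤n ((w , c , weighting , bounded) , _) = LowerBound.0≤a 3≤n {c = c} weighting bounded

  -- From covers to weightings

  module UpperBound {n} {c : Colouring n} (y : Colour → Edge n → Carrier)
                    (0≤y : ∀ x e → 0# ≤ y x e)
                    (covers : ∀ x (H : TriangleOf (colourClass c x)) → 1# ≤ onTriangle (y x) (TriangleOf.H H))
                    where

    u : Edge n → Carrier
    u e = posPart (1# - y (c e) e)

    0≤u : ∀ e → 0# ≤ u e
    0≤u e = 0≤posPart _

    u≤1 : ∀ e → u e ≤ 1#
    u≤1 e = posPart-lub 0≤1 (certify (0≤y (c e) e)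
      (solve 1 (λ y → one ⊜ one :- y :+ y) refl (y (c e) e)))

    u-colour : ∀ {x e} → T (colourClass c x e) → u e ≤ posPart (1# - y x e)
    u-colour {x} {e} e∈ with ≡.refl ← hasColour⇒≡ x (c e) e∈ = ≤-refl

    part : Colour → Edge n → Carrier
    part x = restrict c x u

    part≤1 : ∀ x e → part x e ≤ 1#
    part≤1 x e = restrict-≤ c x {u} 0≤1 (u≤1 e)

    twoOf : ∀ {p q r} → p ≤ 0# → q ≤ 1# → r ≤ 1# → p + q + r ≤ 1# + 1#
    twoOf {p} {q} {r} p≤0 q≤1 r≤1 = certify (+-nonneg (gap p≤0) (+-nonneg (gap q≤1) (gap r≤1)))
      (solve 3 (λ p q r → two ⊜ p :+ q :+ r :+ (nil :- p :+ (one :- q :+ (one :- r)))) refl p q r)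

    rotate : ∀ {p q r} → q + r + p ≤ 1# + 1# → p + q + r ≤ 1# + 1#
    rotate {p} {q} {r} = ≤-trans (≤-reflexive
      (solve 3 (λ p q r → p :+ q :+ r ⊜ q :+ r :+ p) refl p q r))

    -- An edge of the other colour, or one with `y` at least 1, contributes nothing and the other
    -- two at most 1 each. Otherwise the triangle is monochromatic and the covering inequality
    -- applies.
    triangle-bound : ∀ H x → onTriangle (part x) H ≤ 1# + 1#
    triangle-bound H x = monochromatic? (light? (ij H)) (light? (ik H)) (light? (jk H))
      where
      Light : Edge n → Set
      Light e = part x e ≤ 0#

      Heavy : Edge n → Set
      Heavy e = T (colourClass c x e) × part x e ≤ 1# - y x e

      light? : ∀ e → Light e ⊎ Heavy e
      light? e with T? (colourClass c x e)
      ... | no e∉  = inj₁ (≤-reflexive (restrict-out c u e∉))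
      ... | yes e∈ = compare (1# - y x e ≤? 0#)
        where
        part≤ : part x e ≤ posPart (1# - y x e)
        part≤ = ≤-trans (≤-reflexive (restrict-in c u e∈)) (u-colour e∈)

        compare : Dec (1# - y x e ≤ 0#) → Light e ⊎ Heavy e
        compare (yes 1-y≤0) = inj₁ (≤-trans part≤ (≤-reflexive (posPart-zero 1-y≤0)))
        compare (no 1-y≰0)  = inj₂ (e∈ , ≤-trans part≤ (posPart-lub (<⇒≤ 1-y≰0) ≤-refl))

      monochromatic? : Light (ij H) ⊎ Heavy (ij H) → Light (ik H) ⊎ Heavy (ik H) →
                       Light (jk H) ⊎ Heavy (jk H) → onTriangle (part x) H ≤ 1# + 1#
      monochromatic? (inj₁ ij≤0) _ _ = twoOf ij≤0 (part≤1 x (ik H)) (part≤1 x (jk H))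
      monochromatic? (inj₂ _) (inj₁ ik≤0) _ = rotate (twoOf ik≤0 (part≤1 x (jk H)) (part≤1 x (ij H)))
      monochromatic? (inj₂ _) (inj₂ _) (inj₁ jk≤0) =
        rotate (rotate (twoOf jk≤0 (part≤1 x (ij H)) (part≤1 x (ik H))))
      monochromatic? (inj₂ (ij∈ , ij≤)) (inj₂ (ik∈ , ik≤)) (inj₂ (jk∈ , jk≤)) =
        ≤-trans (+-mono-≤ (+-mono-≤ ij≤ ik≤) jk≤)
          (certify (gap (covers x (triangleOf H (ij∈ , ik∈ , jk∈))))
            (solve 3 (λ p q r → two ⊜ one :- p :+ (one :- q) :+ (one :- r) :+ (p :+ q :+ r :- one))
              refl (y x (ij H)) (y x (ik H)) (y x (jk H))))

    pairs S : Carrier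
    pairs = fromℕ (n C 2)
    S = sumEdges ℝ u

    -- On each edge `u` and the cover of its own colour sum to at least 1; the other cover is
    -- nonnegative.
    pairs≤S+y : pairs ≤ S + (sumEdges ℝ (y red) + sumEdges ℝ (y blue))
    pairs≤S+y = ≤-trans (≤-reflexive (sym (sumEdges-one n))) (≤-trans
      (S-mono (isE {n}) {λ _ → 1#} {λ e → u e + (y red e + y blue e)} pointwise)
      (≤-reflexive (trans (S-+ (isE {n}) u (λ e → y red e + y blue e))
        (+-congˡ (S-+ (isE {n}) (y red) (y blue))))))
      where
      own≤sum : ∀ x e → y x e ≤ y red e + y blue e
      own≤sum red  e = certify (0≤y blue e) refl
      own≤sum blue e = certify (0≤y red e) (+-comm _ _)

      pointwise : ∀ e → 1# ≤ u e + (y red e + y blue e)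
      pointwise e = ≤-trans (≤-reflexive (solve 1 (λ y → one ⊜ one :- y :+ y) refl (y (c e) e)))
        (+-mono-≤ (x≤posPart _) (own≤sum (c e) e))

    upperBound : ∀ {a} → Is-wR ℝ n a → 0# < S → a * S ≤ (1# + 1#) * pairs
    upperBound {a} (_ , least) 0<S = ≤-trans (≤-reflexive (*-comm a S))
        (≤-trans (*-monoˡ-≤ (<⇒≤ 0<S) (least (k * (1# + 1#)) (w , c , weighting , bounded)))
          (≤-reflexive (trans (solve 3 (λ s C i → s :* (C :* i :* two) ⊜ two :* (s :* (C :* i)))
                                 refl S pairs (S ⁻¹))
                              (*-congˡ (*-/-cancel 0<S pairs)))))
      where
      -- The scaling that gives `u` the prescribed total weight.
      k = pairs / S
      0≤k = /-nonneg 0<S (fromℕ-nonneg (n C 2))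

      w : Edge n → Carrier
      w e = k * u e

      weighting : IsWeighting ℝ w
      weighting = record
        { nonNegative = λ e → *-nonNegative 0≤k (0≤u e)
        ; total       = trans (S-* (isE {n}) k u) (trans (*-comm k S) (*-/-cancel 0<S pairs))
        }

      bounded : ∀ H x → colourWeight ℝ w c H x ≤ k * (1# + 1#)
      bounded H x = ≤-trans
        (≤-reflexive (trans
          (+-cong (+-cong (restrict-* c x k u (ij H)) (restrict-* c x k u (ik H))) (restrict-* c x k u (jk H)))
          (solve 4 (λ k p q r → k :* p :+ k :* q :+ k :* r ⊜ k :* (p :+ q :+ r))
            refl k (part x (ij H)) (part x (ik H)) (part x (jk H)))))
        (*-monoˡ-≤ 0≤k (triangle-bound H x))

  -- The subtracted `1# + 1#` pays for the two covers, each within 1 of its optimum.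
  upperBound : ∀ {n a t} → 3 ℕ.≤ n → Is-wR ℝ n a → Is-τ*ₙ ℝ n t →
    a * (fromℕ (n C 2) - t - (1# + 1#)) ≤ (1# + 1#) * fromℕ (n C 2)
  upperBound {n} {a} {t} 3≤n isWR ((c , r , b , isR , isB , t≈r+b) , _) = ≤-stable λ fails →
    Duality.nearOptimalCover ℝ (colourClass c red) isR λ (yr , (0≤yr , coversR) , Σyr≤) →
    Duality.nearOptimalCover ℝ (colourClass c blue) isB λ (yb , (0≤yb , coversB) , Σyb≤) →
    let module U = UpperBound {n} {c} (λ { red → yr ; blue → yb })
                     (λ { red → 0≤yr ; blue → 0≤yb }) (λ { red → coversR ; blue → coversB })
        D≤S : fromℕ (n C 2) - t - (1# + 1#) ≤ U.S
        D≤S = certify (+-nonneg (gap U.pairs≤S+y) (+-nonneg (gap (+-mono-≤ Σyr≤ Σyb≤))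
                (gap (≤-reflexive (sym t≈r+b)))))
          (solve 7 (λ C S p q r b t → S ⊜ C :- t :- two :+
              (S :+ (p :+ q) :- C :+ (r :+ one :+ (b :+ one) :- (p :+ q) :+ (t :- (r :+ b)))))
            refl (fromℕ (n C 2)) U.S (sumEdges ℝ yr) (sumEdges ℝ yb) r b t)
        aD≤aS = *-monoˡ-≤ (wR-nonneg 3≤n isWR) D≤S
        -- If `S` were nonpositive, the left side would be at most 0 and the claim would hold
        -- trivially.
        0<S : 0# < U.S
        0<S S≤0 = fails (≤-trans aD≤aS (≤-trans
          (*-monoˡ-≤ (wR-nonneg 3≤n isWR) S≤0)
          (≤-trans (≤-reflexive (zeroʳ a)) (*-nonNegative 0≤2 (fromℕ-nonneg (n C 2))))))
    in fails (≤-trans aD≤aS (U.upperBound isWR 0<S))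

-- Passage to the limit

2*[1+n]C2≡[1+n]*n : ∀ n → 2 ℕ.* (suc n C 2) ≡ suc n ℕ.* n
2*[1+n]C2≡[1+n]*n zero    = ≡.refl
2*[1+n]C2≡[1+n]*n (suc n) = begin
  2 ℕ.* (suc (suc n) C 2)                 ≡⟨ ≡.cong (2 ℕ.*_) (nCk+nC[k+1]≡[n+1]C[k+1] (suc n) 1) ⟨
  2 ℕ.* (suc n C 1 ℕ.+ suc n C 2)         ≡⟨ ≡.cong (λ m → 2 ℕ.* (m ℕ.+ suc n C 2)) (nC1≡n (suc n)) ⟩
  2 ℕ.* (suc n ℕ.+ suc n C 2)             ≡⟨ ℕ.*-distribˡ-+ 2 (suc n) (suc n C 2) ⟩
  2 ℕ.* suc n ℕ.+ 2 ℕ.* (suc n C 2)       ≡⟨ ≡.cong (2 ℕ.* suc n ℕ.+_) (2*[1+n]C2≡[1+n]*n n) ⟩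
  2 ℕ.* suc n ℕ.+ suc n ℕ.* n             ≡⟨ ring n ⟩
  suc (suc n) ℕ.* suc n                   ∎
  where
  open ≡-Reasoning
  open Data.Nat.Solver.+-*-Solver
  ring : ∀ n → 2 ℕ.* suc n ℕ.+ suc n ℕ.* n ≡ suc (suc n) ℕ.* suc n
  ring = solve 1 (λ n → con 2 :* (con 1 :+ n) :+ (con 1 :+ n) :* n :=
                        (con 2 :+ n) :* (con 1 :+ n)) ≡.refl

-- Makes the error term linear in `n`, caused by the excess, negligible against `n C 2`.
k*n≤nC2 : ∀ k {n} → suc (2 ℕ.* k) ℕ.≤ n → k ℕ.* n ℕ.≤ n C 2
k*n≤nC2 k {suc m} (ℕ.s≤s 2k≤m) = ℕ.*-cancelˡ-≤ 2 (begin
  2 ℕ.* (k ℕ.* suc m)    ≡⟨ ℕ.*-assoc 2 k (suc m) ⟨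
  2 ℕ.* k ℕ.* suc m      ≤⟨ ℕ.*-monoˡ-≤ (suc m) 2k≤m ⟩
  m ℕ.* suc m            ≡⟨ ℕ.*-comm m (suc m) ⟩
  suc m ℕ.* m            ≡⟨ 2*[1+n]C2≡[1+n]*n m ⟨
  2 ℕ.* (suc m C 2)      ∎)
  where open ℕ.≤-Reasoning

module LimitIdentity (ℝ : Reals) where
  open Reals ℝ hiding (zero)
  open OrderedField ℝ
  open RamseyBounds ℝ

  -- The products `(ε - x)(B + β)` and `(ε + x)(B - β)` are nonnegative and sum to `2 (ε B - x β)`,
  -- so no absolute values are needed.
  product-bound : ∀ {x β ε B} → x ≤ ε → - x ≤ ε → β ≤ B → - β ≤ B → x * β ≤ ε * B
  product-bound {x} {β} {ε} {B} x≤ε -x≤ε β≤B -β≤B = *-cancelˡ-≤ 0<2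
    (certify (+-nonneg (*-nonNegative (gap x≤ε) (gap -β≤B)) (*-nonNegative (gap -x≤ε) (gap β≤B)))
      (solve 4 (λ x β ε B → two :* (ε :* B) ⊜
          two :* (x :* β) :+ ((ε :- x) :* (B :- :- β) :+ (ε :- :- x) :* (B :- β)))
        refl x β ε B))

  -- The two finite bounds divided by `n C 2`. The hypothesis on `ε` absorbs the error `2 n a` of
  -- the lower bound and the constant 2 of the upper one, and makes `n C 2` positive.
  normalised : ∀ {n a t b ε} → 3 ℕ.≤ n → Is-wR ℝ n a → Is-τ*ₙ ℝ n t → b ≈ t / fromℕ (n C 2) →
               fromℕ n * (1# + 1#) ≤ ε * fromℕ (n C 2) → 0# ≤ ε →
               a * (1# - b - ε) ≤ 1# + 1# × 1# + 1# ≤ a * (1# - b + ε)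
  normalised {n} {a} {t} {b} {ε} 3≤n isWR@((w , c , weighting , bounded) , _) isT b≈ 2n≤εM 0≤ε =
      *-cancelˡ-≤ 0<M (≤-trans (≤-reflexive (trans
        (solve 4 (λ a b ε M → M :* (a :* (one :- b :- ε)) ⊜ a :* (M :- M :* b :- ε :* M)) refl a b ε M)
        (*-congˡ (+-congʳ (+-congˡ (-‿cong Mb≈t))))))
      (≤-trans (*-monoˡ-≤ 0≤a (+-mono-≤ (≤-refl {M - t}) (certify (gap 2≤εM)
        (solve 1 (λ u → :- two ⊜ :- u :+ (u :- two)) refl (ε * M)))))
      (≤-trans (upperBound 3≤n isWR isT) (≤-reflexive (*-comm _ M))))) ,
      *-cancelˡ-≤ 0<M (certify
        (+-nonneg (gap (LowerBound.lowerBound 3≤n {c = c} weighting bounded isT))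
          (+-nonneg (*-nonNegative 0≤a (gap 2n≤εM)) (*-nonNegative 0≤a (gap (≤-reflexive Mb≈t)))))
        (solve 6 (λ a b t ε M N → M :* (a :* (one :- b :+ ε)) ⊜ M :* two :+
            (a :* M :+ N :* (a :+ a) :- (two :* M :+ a :* t) :+
             (a :* (ε :* M :- N :* two) :+ a :* (t :- M :* b))))
          refl a b t ε M (fromℕ n)))
    where
    M = fromℕ (n C 2)
    0≤a = wR-nonneg 3≤n isWR

    2≤εM : 1# + 1# ≤ ε * M
    2≤εM = ≤-trans (≤-trans (≤-reflexive (sym (*-identityˡ _)))
      (≤-trans (≤-reflexive (*-comm _ _)) (≤-trans (*-monoˡ-≤ 0≤2 1≤n) (≤-reflexive (*-comm _ _))))) 2n≤εM
      where
      1≤n : 1# ≤ fromℕ n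
      1≤n = ≤-trans (≤-reflexive (sym (+-identityʳ 1#))) (fromℕ-mono (ℕ.≤-trans (ℕ.s≤s ℕ.z≤n) 3≤n))

    0<M : 0# < M
    0<M M≤0 = 0<2 (≤-trans 2≤εM (≤-trans (*-monoˡ-≤ 0≤ε M≤0) (≤-reflexive (zeroʳ ε))))

    Mb≈t : M * b ≈ t
    Mb≈t = trans (*-congˡ b≈) (*-/-cancel 0<M t)

  module _ {W τ : Carrier} where
    β = 1# - τ
    -- `B` is the absolute value of `β`. In `k`, replacing `a` by `W` costs `B ε`, while replacing
    -- `b` by `τ` and dropping the `ε` of `normalised` cost `a ε` each, with `a` at most
    -- `posPart W + 1#`.
    B = posPart β + posPart (- β)
    k = (1# + 1#) * (posPart W + 1#) + B

    0≤B : 0# ≤ B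
    0≤B = +-nonneg (0≤posPart β) (0≤posPart (- β))

    0≤W⁺+1 : 0# ≤ posPart W + 1#
    0≤W⁺+1 = +-nonneg (0≤posPart W) 0≤1

    0≤k : 0# ≤ k
    0≤k = +-nonneg (*-nonNegative 0≤2 0≤W⁺+1) 0≤B

    β≤B : β ≤ B
    β≤B = ≤-trans (x≤posPart β) (certify (0≤posPart (- β)) refl)

    -β≤B : - β ≤ B
    -β≤B = ≤-trans (x≤posPart (- β)) (certify (0≤posPart β) (+-comm _ _))

    approximate : ∀ {a b ε} → ε ≤ 1# → 0# ≤ ε → 0# ≤ a →
      W - ε ≤ a → a ≤ W + ε → τ - ε ≤ b → b ≤ τ + ε →
      a * (1# - b - ε) ≤ 1# + 1# × 1# + 1# ≤ a * (1# - b + ε) →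
      W * β ≤ 1# + 1# + k * ε × 1# + 1# ≤ W * β + k * ε
    approximate {a} {b} {ε} ε≤1 0≤ε 0≤a W-ε≤a a≤W+ε τ-ε≤b b≤τ+ε (upper , lower) =
      certify (+-nonneg (gap upper) (+-nonneg (*-nonNegative 0≤a (gap b≤τ+ε))
        (+-nonneg (gap (product-bound W-a≤ε a-W≤ε β≤B -β≤B)) 2aε≤)))
        (solve 7 (λ W τ a b ε B w → two :+ (two :* (w :+ one) :+ B) :* ε ⊜ W :* (one :- τ) :+
            (two :- a :* (one :- b :- ε) :+ (a :* (τ :+ ε :- b) :+
            (ε :* B :- (W :- a) :* (one :- τ) :+ (two :* ε :* (w :+ one :- a))))) )
          refl W τ a b ε B (posPart W)) ,
      certify (+-nonneg (gap lower) (+-nonneg (*-nonNegative 0≤a (gap τ-ε≤b))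
        (+-nonneg (gap (product-bound a-W≤ε′ W-a≤ε′ β≤B -β≤B)) 2aε≤)))
        (solve 7 (λ W τ a b ε B w → W :* (one :- τ) :+ (two :* (w :+ one) :+ B) :* ε ⊜ two :+
            (a :* (one :- b :+ ε) :- two :+ (a :* (b :- (τ :- ε)) :+
            (ε :* B :- (a :- W) :* (one :- τ) :+ (two :* ε :* (w :+ one :- a))))) )
          refl W τ a b ε B (posPart W))
      where
      W-a≤ε : W - a ≤ ε
      W-a≤ε = certify (gap W-ε≤a) (solve 3 (λ W a ε → ε ⊜ W :- a :+ (a :- (W :- ε))) refl W a ε)

      a-W≤ε′ : a - W ≤ ε
      a-W≤ε′ = certify (gap a≤W+ε) (solve 3 (λ W a ε → ε ⊜ a :- W :+ (W :+ ε :- a)) refl W a ε)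

      a-W≤ε : - (W - a) ≤ ε
      a-W≤ε = ≤-trans (≤-reflexive (solve 2 (λ W a → :- (W :- a) ⊜ a :- W) refl W a)) a-W≤ε′

      W-a≤ε′ : - (a - W) ≤ ε
      W-a≤ε′ = ≤-trans (≤-reflexive (solve 2 (λ W a → :- (a :- W) ⊜ W :- a) refl W a)) W-a≤ε

      2aε≤ : 0# ≤ (1# + 1#) * ε * (posPart W + 1# - a)
      2aε≤ = *-nonNegative (*-nonNegative 0≤2 0≤ε) (gap (≤-trans a≤W+ε (+-mono-≤ (x≤posPart W) ε≤1)))

    W*β-near-2 : Is-𝐖 ℝ W → Is-τ*∞ ℝ τ → ∀ ε → 0# < ε → ε ≤ 1# →
      ¬ ¬ (W * β ≤ 1# + 1# + k * ε × 1# + 1# ≤ W * β + k * ε)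
    W*β-near-2 (wR , isWR , wR→W) (τ*ₙ , isT , τ*ₙ→τ) ε 0<ε ε≤1 fails =
      archimedean ((1# + 1#) / ε) λ (m , 2/ε≤m) →
      let N₁ , near₁ = wR→W ε (<⇒<ᵣ 0<ε)
          N₂ , near₂ = τ*ₙ→τ ε (<⇒<ᵣ 0<ε)
          -- Beyond `2 m` the number of pairs is at least `m n`, and `ε m` is at least 2, as
          -- `normalised` requires.
          n = N₁ ⊔ N₂ ⊔ (3 ⊔ suc (2 ℕ.* m))
          N₁≤n = ℕ.≤-trans (ℕ.m≤m⊔n N₁ N₂) (ℕ.m≤m⊔n (N₁ ⊔ N₂) (3 ⊔ suc (2 ℕ.* m)))
          N₂≤n = ℕ.≤-trans (ℕ.m≤n⊔m N₁ N₂) (ℕ.m≤m⊔n (N₁ ⊔ N₂) (3 ⊔ suc (2 ℕ.* m)))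
          3≤n  = ℕ.≤-trans (ℕ.m≤m⊔n 3 (suc (2 ℕ.* m))) (ℕ.m≤n⊔m (N₁ ⊔ N₂) (3 ⊔ suc (2 ℕ.* m)))
          2m<n = ℕ.≤-trans (ℕ.m≤n⊔m 3 (suc (2 ℕ.* m))) (ℕ.m≤n⊔m (N₁ ⊔ N₂) (3 ⊔ suc (2 ℕ.* m)))
          (W-ε<a , _) , (a<W+ε , _) = near₁ n N₁≤n
          (τ-ε<b , _) , (b<τ+ε , _) = near₂ n N₂≤n
          0≤ε = <⇒≤ 0<ε
          2≤εm : 1# + 1# ≤ ε * fromℕ m
          2≤εm = ≤-trans (≤-reflexive (sym (*-/-cancel 0<ε (1# + 1#)))) (*-monoˡ-≤ 0≤ε 2/ε≤m)
          2n≤εC : fromℕ n * (1# + 1#) ≤ ε * fromℕ (n C 2)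
          2n≤εC = ≤-trans (*-monoˡ-≤ (fromℕ-nonneg n) 2≤εm) (≤-trans
            (≤-reflexive (trans (solve 3 (λ n e m → n :* (e :* m) ⊜ e :* (m :* n)) refl (fromℕ n) ε (fromℕ m))
              (*-congˡ (sym (fromℕ-* m n)))))
            (*-monoˡ-≤ 0≤ε (fromℕ-mono (k*n≤nC2 m 2m<n))))
      in fails (approximate ε≤1 0≤ε (wR-nonneg 3≤n (isWR n 3≤n)) W-ε<a a<W+ε τ-ε<b b<τ+ε
           (normalised 3≤n (isWR n 3≤n) (isT n) refl 2n≤εC 0≤ε))

    W*β≈2 : Is-𝐖 ℝ W → Is-τ*∞ ℝ τ → W * β ≈ 1# + 1#
    W*β≈2 isW isτ = ≤-antisym
      (≤-from-ε 0≤k λ ε 0<ε ε≤1 → ≤-stable λ fails → W*β-near-2 isW isτ ε 0<ε ε≤1 λ (≤2 , _) → fails ≤2)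
      (≤-from-ε 0≤k λ ε 0<ε ε≤1 → ≤-stable λ fails → W*β-near-2 isW isτ ε 0<ε ε≤1 λ (_ , 2≤) → fails 2≤)

theorem5 : (ℝ : Reals) → let open Reals ℝ in
    ∀ (W τ : Carrier) → Is-𝐖 ℝ W → Is-τ*∞ ℝ τ →
    (1# - τ ≉ 0#) × (W ≈ (1# + 1#) / (1# - τ))
theorem5 ℝ W τ isW isτ = β≉0 ,
    trans (sym (*-identityʳ W)) (trans (*-congˡ (sym (⁻¹-inverseʳ (1# - τ) β≉0)))
      (trans (sym (*-assoc W (1# - τ) _)) (*-congʳ Wβ≈2)))
  where
  open Reals ℝ hiding (zero)
  open OrderedField ℝ

  Wβ≈2 : W * (1# - τ) ≈ 1# + 1#
  Wβ≈2 = LimitIdentity.W*β≈2 ℝ isW isτ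

  -- A factor of 2 cannot vanish; hence the division is not by 0, where the inverse is unspecified.
  β≉0 : 1# - τ ≉ 0#
  β≉0 β≈0 = 0<2 (≤-reflexive (trans (sym Wβ≈2) (trans (*-congˡ β≈0) (zeroʳ W))))
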